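{- There is a polynomial-time reduction from \texttt{G-mDST} to \texttt{G-DCST}.
   Context: For a graph $G$ and a digraph $D$ with vertex set $E(G)$, let $\mathrm{dep}(e)=\{e'\in E(G):(e',e)\in E(D)\}$. Given $\ell,u:E(G)\to\mathbb{N}$, a subgraph $H$ of $G$ $(\ell,u)$-satisfies $D$ if $\ell(e)\le|\mathrm{dep}(e)\cap E(H)|\le u(e)$ for every $e\in E(H)$. \texttt{G-DCST} asks, given $(G,D,\ell,u)$, whether $G$ has a spanning tree that $(\ell,u)$-satisfies $D$. \texttt{G-mDST} (Generalized Minimum Degree Constrained Spanning Tree): given a graph $G=(V,E)$ and functions $\ell,u:V\to\mathbb{N}$, decide whether $G$ has a spanning tree $T$ such that $\ell(v)\le d_T(v)\le u(v)$ for every non-leaf vertex $v$ of $T$, where $d_T(v)$ is the degree of $v$ in $T$. -}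

module Defs where

open import Data.Bool using (Bool; true; false)
open import Data.Digit using (Bit; toDigits)
open import Data.Fin using (Fin; zero; suc)
open import Data.Fin.Subset using (Subset; _∈_; _∩_; _∪_; ⁅_⁆; ∣_∣)
open import Data.List using (List; []; _∷_; _++_; _∷ʳ_; [_]; length; map; concatMap; allFin; replicate)
open import Data.List.Relation.Unary.Linked using (Linked)
open import Data.List.Relation.Unary.Unique.Propositional using (Unique)
open import Data.Maybe using (Maybe; just; nothing)
open import Data.Nat using (ℕ; zero; suc; _+_; _*_; _^_; _≤_; NonZero)
open import Data.Product using (Σ; ∃; ∃-syntax; _×_; _,_; proj₁)
open import Data.Vec as Vec using (Vec; lookup; tabulate; toList; _[_]%=_; _[_]≔_)
open import Function.Bundles using (_⇔_; _↔_)
open import Function.Definitions using (Injective)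
open import Relation.Binary.Construct.Closure.ReflexiveTransitive using (Star)
open import Relation.Binary.PropositionalEquality using (_≡_; _≢_)
open import Relation.Nullary using (¬_)

------------------------------------------------------------------------
-- Graphs

-- A finite simple graph: the edges are pairwise distinct 2-element
-- subsets of the vertex set Fin order, numbered by Fin size.
record Graph : Set where
  field
    order          : ℕ
    size           : ℕ
    ends           : Fin size → Subset order
    ends-two       : ∀ e → ∣ ends e ∣ ≡ 2
    ends-injective : Injective _≡_ _≡_ ends

  Vertex : Set
  Vertex = Fin order

  Edge : Set
  Edge = Fin size

  -- Spanning subgraphs are given by their edge sets.
  EdgeSet : Set
  EdgeSet = Subset size

  Adjacent : EdgeSet → Vertex → Vertex → Set
  Adjacent H v w = ∃[ e ] e ∈ H × ends e ≡ ⁅ v ⁆ ∪ ⁅ w ⁆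

  -- Connected graphs are nonempty.
  Connected : EdgeSet → Set
  Connected H = NonZero order × (∀ v w → Star (Adjacent H) v w)

  -- v ∷ vs lists the vertices of a cycle of length at least 3.
  IsCycle : EdgeSet → Vertex → List Vertex → Set
  IsCycle H v vs =
    2 ≤ length vs × Unique (v ∷ vs) × Linked (Adjacent H) (v ∷ vs ∷ʳ v)

  Acyclic : EdgeSet → Set
  Acyclic H = ∀ v vs → ¬ IsCycle H v vs

  IsSpanningTree : EdgeSet → Set
  IsSpanningTree T = Connected T × Acyclic T

  incident : Vertex → EdgeSet
  incident v = tabulate λ e → lookup (ends e) v

  degree : EdgeSet → Vertex → ℕ
  degree H v = ∣ incident v ∩ H ∣

  IsLeaf : EdgeSet → Vertex → Set
  IsLeaf H v = degree H v ≡ 1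

record Digraph (n : ℕ) : Set where
  field
    arc      : Fin n → Fin n → Bool
    loopless : ∀ x → arc x x ≡ false

------------------------------------------------------------------------
-- Instances and their solutions

record MDSTInstance : Set where
  field
    graph : Graph
  open Graph graph public
  field
    ℓ u : Vertex → ℕ

  Solvable : Set
  Solvable = ∃[ T ] IsSpanningTree T ×
    (∀ v → ¬ IsLeaf T v → ℓ v ≤ degree T v × degree T v ≤ u v)

record DCSTInstance : Set where
  field
    graph : Graph
  open Graph graph public
  field
    dependency : Digraph size
    ℓ u        : Edge → ℕ
  open Digraph dependency public

  dep : Edge → EdgeSet
  dep e = tabulate λ e′ → arc e′ e

  Satisfies : EdgeSet → Set
  Satisfies H = ∀ e → e ∈ H → ℓ e ≤ ∣ dep e ∩ H ∣ × ∣ dep e ∩ H ∣ ≤ u e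

  Solvable : Set
  Solvable = ∃[ T ] IsSpanningTree T × Satisfies T

------------------------------------------------------------------------
-- Encodings

data Symbol : Set where
  bit : Bool → Symbol
  #   : Symbol

Word : Set
Word = List Symbol

-- Used only for the numbers of vertices and edges: listing these already
-- takes linear space, so this does not inflate the input.
unary : ℕ → Word
unary n = replicate n (bit true) ∷ʳ #

digit : Bit → Symbol
digit zero       = bit false
digit (suc zero) = bit true

-- Least significant digit first.
binary : ℕ → Word
binary n = map digit (proj₁ (toDigits 2 n)) ∷ʳ #

bits : ∀ {n} → Vec Bool n → Word
bits v = map bit (toList v) ∷ʳ #

-- The order, the size and the edge-vertex incidence matrix.
encodeGraph : Graph → Word
encodeGraph G = unary order ++ unary size ++ concatMap (λ e → bits (ends e)) (allFin size)
  where open Graph G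

-- The adjacency matrix.
encodeDigraph : ∀ {n} → Digraph n → Word
encodeDigraph {n} D = concatMap (λ x → bits (tabulate (arc x))) (allFin n)
  where open Digraph D

encodeBounds : ∀ {n} → (Fin n → ℕ) → (Fin n → ℕ) → Word
encodeBounds {n} ℓ u = concatMap (λ x → binary (ℓ x) ++ binary (u x)) (allFin n)

encodeMDST : MDSTInstance → Word
encodeMDST I = encodeGraph graph ++ encodeBounds ℓ u
  where open MDSTInstance I

encodeDCST : DCSTInstance → Word
encodeDCST I = encodeGraph graph ++ encodeDigraph dependency ++ encodeBounds ℓ u
  where open DCSTInstance I

record DecisionProblem : Set₁ where
  field
    Instance : Set
    encode   : Instance → Word
    Yes      : Instance → Set

G-mDST : DecisionProblem
G-mDST = record
  { Instance = MDSTInstance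
  ; encode   = encodeMDST
  ; Yes      = MDSTInstance.Solvable
  }

G-DCST : DecisionProblem
G-DCST = record
  { Instance = DCSTInstance
  ; encode   = encodeDCST
  ; Yes      = DCSTInstance.Solvable
  }

------------------------------------------------------------------------
-- Polynomial-time computation

data Instruction (stacks : ℕ) (State : Set) : Set where
  push : Fin stacks → Symbol → State → Instruction stacks State
  pop  : Fin stacks → (Maybe Symbol → State) → Instruction stacks State
  halt : Instruction stacks State

-- Machines with finite control and finitely many stacks.  Two stacks
-- make up one tape and a tape can hold a stack, so these are multitape
-- Turing machines up to a constant factor in the running time.
record Machine : Set₁ where
  field
    stacks       : ℕ
    State        : Set
    finite       : ∃[ q ] State ↔ Fin q
    start        : State
    instruction  : State → Instruction stacks State
    input output : Fin stacks

  Memory : Set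
  Memory = Vec Word stacks

  Config : Set
  Config = State × Memory

  top : Word → Maybe Symbol
  top []      = nothing
  top (a ∷ _) = just a

  rest : Word → Word
  rest []      = []
  rest (_ ∷ w) = w

  execute : Instruction stacks State → Memory → Maybe Config
  execute (push i a q) m = just (q , m [ i ]%= (a ∷_))
  execute (pop i k)    m = just (k (top (lookup m i)) , m [ i ]%= rest)
  execute halt         m = nothing

  -- nothing if the configuration is halting.
  step : Config → Maybe Config
  step (q , m) = execute (instruction q) m

  -- Run c t d: from c the machine halts in d after exactly t steps.
  data Run : Config → ℕ → Config → Set where
    stop : ∀ {c} → step c ≡ nothing → Run c 0 c
    next : ∀ {c c′ d t} → step c ≡ just c′ → Run c′ t d → Run c (suc t) d

  initial : Word → Config
  initial w = start , Vec.replicate stacks [] [ input ]≔ w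

  -- Words are read off stacks from the top; the other stacks may hold
  -- anything at the end.
  ComputesIn : Word → ℕ → Word → Set
  ComputesIn w t w′ =
    ∃[ q ] ∃[ m ] Run (initial w) t (q , m) × lookup m output ≡ w′

-- Every polynomial is bounded on ℕ by one of the form c * n ^ d + c.
PolynomialTime : {A B : Set} → (A → Word) → (B → Word) → (A → B) → Set₁
PolynomialTime encodeA encodeB f =
  Σ Machine λ M → ∃[ c ] ∃[ d ] ∀ x → ∃[ t ]
    t ≤ c * length (encodeA x) ^ d + c ×
    Machine.ComputesIn M (encodeA x) t (encodeB (f x))

infix 4 _≤ₚ_

-- Polynomial-time many-one (Karp) reducibility.
_≤ₚ_ : DecisionProblem → DecisionProblem → Set₁
P ≤ₚ Q = Σ (P.Instance → Q.Instance) λ f →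
  PolynomialTime P.encode Q.encode f × (∀ x → P.Yes x ⇔ Q.Yes (f x))
  where
  module P = DecisionProblem P
  module Q = DecisionProblem Q

{-# OPTIONS --safe #-}

module Submission where

-- Glue to every vertex v a triangle v v′ v″.  A spanning tree of the new
-- graph consists of a spanning tree T of the old one and two edges of each
-- triangle, hence contains v v′ or v v″.  Let both of these edges depend on
-- the old edges at v, the first with the bounds of v and the second with
-- the bounds 1 and 1: the first may be chosen if v obeys its bounds in T,
-- the second if v is a leaf of T.
--
-- For the running time, programs built from loops over stacks are compiled
-- to machines.  As no loop iterates more often than the length of the
-- input, the nesting of the loops bounds the time by a polynomial.

-- The bounds of an edge bind only if it is chosen, whereas those of a vertex bind unless it is a
-- leaf. The exemption of leaves is a disjunction, which a pendant edge at `v` cannot express: every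
-- spanning tree would contain that edge and be subject to its bounds. The triangle leaves a choice
-- between two edges, one for each disjunct; its third edge `v′ v″` is free and keeps the remaining
-- vertex attached. A tree with both edges at `v` does no harm: then `v` is a leaf that also obeys
-- its bounds. The machine does no arithmetic. The only new bounds are 0 and 1, and the edges are
-- numbered so that those with the bounds of the vertices come last; thus the end of the input word
-- is copied to the end of the output.

open import Defs
open import Data.Bool using (Bool; true; false; not)
open import Data.Bool.Properties using (T-≡)
import Data.Empty as Empty
open import Data.Fin using (Fin; zero; suc; toℕ; _≟_; combine; remQuot; splitAt; _↑ˡ_; _↑ʳ_)
open import Data.Fin.Properties using (0↔⊥; 1↔⊤; +↔⊎; all?; any?; splitAt-↑ˡ; splitAt-↑ʳ; splitAt⁻¹-↑ˡ; splitAt⁻¹-↑ʳ; remQuot-combine; combine-remQuot; combine-injective)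
open import Data.Fin.Subset using (Subset; _∈_; _∉_; _∩_; _∪_; ⁅_⁆; ∣_∣; ⊥)
open import Data.Fin.Subset.Properties using (_∈?_; ∉⊥; ∣⊥∣≡0; x∈⁅x⁆; x∈⁅y⁆⇒x≡y; ∣⁅x⁆∣≡1; ⊆-antisym; ∩-zeroˡ; x∈p∪q⁺; x∈p∪q⁻; ∪-comm)
open import Data.List as List using (List; []; _∷_; _++_; _∷ʳ_; [_]; _ʳ++_; length; head; drop; concat; concatMap; tabulate; foldr; foldl; reverse; allFin; _∷ʳ′_; initLast)
open import Data.List.Membership.Propositional as List using ()
open import Data.List.Membership.Propositional.Properties using (∈-∃++; ∈-++⁺ʳ)
open import Data.List.Properties using (ʳ++-defn; ʳ++-ʳ++; ++-assoc; ++-identityʳ; map-++; map-tabulate; tabulate-cong; length-map; length-++; length-reverse; length-tabulate; reverse-involutive; reverse-map; reverse-foldr; reverse-foldl)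
open import Data.List.Relation.Binary.Permutation.Propositional using (_↭_; ↭-sym; ↭⇒↭ₛ)
open import Data.List.Relation.Binary.Permutation.Propositional.Properties using (++-comm; ∈-resp-↭; ↭-length)
open import Data.List.Relation.Binary.Permutation.Setoid.Properties using (Unique-resp-↭)
open import Data.List.Relation.Unary.All as All using (_∷_)
open import Data.List.Relation.Unary.AllPairs using (_∷_)
open import Data.List.Relation.Unary.Any using (here; there)
open import Data.List.Relation.Unary.Linked as Linked using (Linked; [-]; _∷_)
import Data.List.Relation.Unary.Linked.Properties as Linked
open import Data.List.Relation.Unary.Unique.Propositional using (Unique)
import Data.List.Relation.Unary.Unique.Propositional.Properties as Unique
open import Data.Maybe using (Maybe; just; nothing; _>>=_)
open import Data.Nat as ℕ using (ℕ; zero; suc; _+_; _*_; _^_; _∸_; _≤_; _<_; NonZero; >-nonZero; z≤n; s≤s)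
open import Data.Nat.Properties hiding (_≟_)
open import Data.Product using (∃; ∃-syntax; ∃₂; _×_; _,_; proj₁; proj₂; map₂; uncurry)
open import Data.Sum using (_⊎_; inj₁; inj₂; [_,_]′)
open import Data.Sum.Function.Propositional using (_⊎-↔_)
open import Data.Unit using (⊤; tt)
open import Data.Vec as Vec using (Vec; []; _∷_; lookup; toList; _[_]%=_; _[_]≔_)
open import Data.Vec.Properties as Vec using (updateAt-cong; lookup-concat; lookup⇒[]=; []=⇒lookup; lookup∘update; lookup∘update′; lookup-replicate; lookup∘tabulate; tabulate∘lookup; ++-injectiveˡ; lookup-++ˡ; lookup-++ʳ; zipWith-++; length-toList)
open import Function using (_∘_; id; const)
open import Function.Bundles using (Equivalence; _⇔_; mk⇔; _↔_; mk↔ₛ′)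
open import Function.Construct.Composition using (_↔-∘_)
open import Function.Construct.Symmetry using (↔-sym)
open import Relation.Binary.Construct.Closure.ReflexiveTransitive as Star using (Star; ε; _◅_; _◅◅_; gmap)
open import Relation.Binary.PropositionalEquality hiding ([_])
open import Relation.Nullary using (¬_; yes; no; contradiction)
open import Relation.Nullary.Decidable using (toWitness; ¬?; _×-dec_; _⊎-dec_; _→-dec_)

-- Programs with loops over stacks

-- A loop pops a symbol and runs the body selected by it; it ends when the
-- stack is empty or when no body is selected.
data Program (κ : ℕ) : Set where
  push : Fin κ → Symbol → Program κ
  _⨾_  : Program κ → Program κ → Program κ
  loop : Fin κ → (Symbol → Maybe (Program κ)) → Program κ

infixr 5 _⨾_

private variable
  κ : ℕ

Stacks : ℕ → Set
Stacks κ = Vec Word κ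

-- B bounds the number of iterations of every loop, which makes the time
-- polynomial in B.
data Exec (B : ℕ) {κ : ℕ} : Program κ → Stacks κ → Stacks κ → Set
data Loop (B : ℕ) {κ : ℕ} (i : Fin κ) (f : Symbol → Maybe (Program κ)) : ℕ → Stacks κ → Stacks κ → Set

data Exec B where
  push : ∀ {i a m} → Exec B (push i a) m (m [ i ]%= (a ∷_))
  _⨾_  : ∀ {p q l m n} → Exec B p l m → Exec B q m n → Exec B (p ⨾ q) l n
  loop : ∀ {i f r m n} → r < B → Loop B i f r m n → Exec B (loop i f) m n

data Loop B i f where
  -- The symbol that selects no body is popped as well; this is how the separator `#` behind a
  -- number or a row is consumed.
  exit : ∀ {m} → (head (lookup m i) >>= f) ≡ nothing → Loop B i f 0 m (m [ i ]%= drop 1)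
  next : ∀ {a p r l m n} → head (lookup l i) ≡ just a → f a ≡ just p →
         Exec B p (l [ i ]%= drop 1) m → Loop B i f r m n → Loop B i f (suc r) l n

-- Running time

mutual
  -- A loop of `r` iterations pops `r + 1` times, which is at most `B`. The `suc` counts the pop,
  -- and the sum over the three symbols bounds whichever body is selected.
  time : ℕ → Program κ → ℕ
  time B (push _ _) = 1
  time B (p ⨾ q)    = time B p + time B q
  time B (loop i f) = B * suc (bodyTime B (f (bit true)) + (bodyTime B (f (bit false)) + bodyTime B (f #)))

  bodyTime : ℕ → Maybe (Program κ) → ℕ
  bodyTime B (just p) = time B p
  bodyTime B nothing  = 0

-- A single monomial suffices because `B ≥ 1`: raising the exponent does not decrease `B ^ d`, so
-- two monomials fit under one with exponent `d + d′`. At `B = 0` this fails, as `0 ^ 0` is 1.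
PolynomiallyBounded : (ℕ → ℕ) → Set
PolynomiallyBounded g = ∃[ c ] ∃[ d ] (∀ B → .{{NonZero B}} → g B ≤ c * B ^ d)

const-polynomial : ∀ c → PolynomiallyBounded (const c)
const-polynomial c = c , 0 , λ B → ≤-reflexive (sym (*-identityʳ c))

+-polynomial : ∀ {g h} → PolynomiallyBounded g → PolynomiallyBounded h → PolynomiallyBounded (λ B → g B + h B)
+-polynomial {g} {h} (c , d , g≤) (c′ , d′ , h≤) = c + c′ , d + d′ , λ B → begin
  g B + h B                                 ≤⟨ +-mono-≤ (g≤ B) (h≤ B) ⟩
  c * B ^ d + c′ * B ^ d′                   ≤⟨ +-mono-≤ (*-monoʳ-≤ c (^-monoʳ-≤ B (m≤m+n d d′)))
                                                        (*-monoʳ-≤ c′ (^-monoʳ-≤ B (m≤n+m d′ d))) ⟩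
  c * B ^ (d + d′) + c′ * B ^ (d + d′)      ≡⟨ *-distribʳ-+ (B ^ (d + d′)) c c′ ⟨
  (c + c′) * B ^ (d + d′)                   ∎
  where open ≤-Reasoning

B*-polynomial : ∀ {g} → PolynomiallyBounded g → PolynomiallyBounded (λ B → B * g B)
B*-polynomial {g} (c , d , g≤) = c , suc d , λ B → begin
  B * g B           ≤⟨ *-monoʳ-≤ B (g≤ B) ⟩
  B * (c * B ^ d)   ≡⟨ *-assoc B c (B ^ d) ⟨
  B * c * B ^ d     ≡⟨ cong (_* B ^ d) (*-comm B c) ⟩
  c * B * B ^ d     ≡⟨ *-assoc c B (B ^ d) ⟩
  c * B ^ suc d     ∎
  where open ≤-Reasoning

mutual
  time-polynomial : (p : Program κ) → PolynomiallyBounded (λ B → time B p)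
  time-polynomial (push _ _) = const-polynomial 1
  time-polynomial (p ⨾ q)    = +-polynomial (time-polynomial p) (time-polynomial q)
  time-polynomial (loop i f) = B*-polynomial (+-polynomial (const-polynomial 1)
    (+-polynomial (bodyTime-polynomial (f (bit true)))
      (+-polynomial (bodyTime-polynomial (f (bit false))) (bodyTime-polynomial (f #)))))

  bodyTime-polynomial : (b : Maybe (Program κ)) → PolynomiallyBounded (λ B → bodyTime B b)
  bodyTime-polynomial (just p) = time-polynomial p
  bodyTime-polynomial nothing  = const-polynomial 0

-- Compilation

mutual
  -- The control states are the positions of instructions in the syntax tree: one for each `push`
  -- and one for the pop of each loop. Bodies are given by a function, but on three symbols only, so
  -- there are finitely many positions.
  Point : Program κ → Set
  Point (push _ _) = ⊤
  Point (p ⨾ q)    = Point p ⊎ Point q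
  Point (loop i f) = ⊤ ⊎ ∃ λ a → BodyPoint (f a)

  BodyPoint : Maybe (Program κ) → Set
  BodyPoint (just p) = Point p
  BodyPoint nothing  = Empty.⊥

entry : (p : Program κ) → Point p
entry (push _ _) = tt
entry (p ⨾ q)    = inj₁ (entry p)
entry (loop _ _) = inj₁ tt

module _ {Q : Set} where
  continue : (b : Maybe (Program κ)) → (BodyPoint b → Q) → Q → Q
  continue (just p) ι x = ι (entry p)
  continue nothing  ι x = x

  branch : (f : Symbol → Maybe (Program κ)) → (∃ (BodyPoint ∘ f) → Q) → Q → Maybe Symbol → Q
  branch f ι x nothing  = x
  branch f ι x (just a) = continue (f a) (λ s → ι (a , s)) x

  branch-exit : ∀ (f : Symbol → Maybe (Program κ)) ι x a → (a >>= f) ≡ nothing → branch f ι x a ≡ x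
  branch-exit f ι x nothing  _  = refl
  branch-exit f ι x (just a) fa = continue-exit (f a) fa
    where
    continue-exit : ∀ b {ι} → b ≡ nothing → continue b ι x ≡ x
    continue-exit nothing _ = refl

  -- The point s of p is the state ι s, and p is left to the state x.
  mutual
    code : (p : Program κ) → (Point p → Q) → Q → Point p → Instruction κ Q
    code (push i a) ι x _        = push i a x
    code (p ⨾ q)    ι x (inj₁ s) = code p (ι ∘ inj₁) (ι (inj₂ (entry q))) s
    code (p ⨾ q)    ι x (inj₂ s) = code q (ι ∘ inj₂) x s
    code (loop i f) ι x (inj₁ _) = pop i (branch f (ι ∘ inj₂) x)
    -- A body is left to the pop of its own loop.
    code (loop i f) ι x (inj₂ (a , s)) = bodyCode (f a) (λ s → ι (inj₂ (a , s))) (ι (inj₁ tt)) s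

    bodyCode : (b : Maybe (Program κ)) → (BodyPoint b → Q) → Q → BodyPoint b → Instruction κ Q
    bodyCode (just p) ι x s = code p ι x s

-- Finiteness of the control

Finite : Set → Set
Finite A = ∃[ q ] A ↔ Fin q

⊤-finite : Finite ⊤
⊤-finite = 1 , ↔-sym 1↔⊤

⊎-finite : {A B : Set} → Finite A → Finite B → Finite (A ⊎ B)
⊎-finite (_ , A↔) (_ , B↔) = _ , ↔-sym +↔⊎ ↔-∘ (A↔ ⊎-↔ B↔)

Σ-Symbol↔⊎ : {A : Symbol → Set} → ∃ A ↔ (A (bit true) ⊎ A (bit false) ⊎ A #)
Σ-Symbol↔⊎ = mk↔ₛ′
  (λ { (bit true , x) → inj₁ x ; (bit false , x) → inj₂ (inj₁ x) ; (# , x) → inj₂ (inj₂ x) })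
  (λ { (inj₁ x) → _ , x ; (inj₂ (inj₁ x)) → _ , x ; (inj₂ (inj₂ x)) → _ , x })
  (λ { (inj₁ x) → refl ; (inj₂ (inj₁ x)) → refl ; (inj₂ (inj₂ x)) → refl })
  (λ { (bit true , x) → refl ; (bit false , x) → refl ; (# , x) → refl })

mutual
  Point-finite : (p : Program κ) → Finite (Point p)
  Point-finite (push _ _) = ⊤-finite
  Point-finite (p ⨾ q)    = ⊎-finite (Point-finite p) (Point-finite q)
  Point-finite (loop i f) = ⊎-finite ⊤-finite (map₂ (_↔-∘ Σ-Symbol↔⊎)
    (⊎-finite (BodyPoint-finite (f (bit true)))
      (⊎-finite (BodyPoint-finite (f (bit false))) (BodyPoint-finite (f #)))))

  BodyPoint-finite : (b : Maybe (Program κ)) → Finite (BodyPoint b)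
  BodyPoint-finite (just p) = Point-finite p
  BodyPoint-finite nothing  = 0 , ↔-sym 0↔⊥

-- The compiled machine and its running time

machine : Program κ → Fin κ → Fin κ → Machine
machine {κ} p i o = record
  { stacks      = κ
  ; State       = ⊤ ⊎ Point p
  ; finite      = ⊎-finite ⊤-finite (Point-finite p)
  ; start       = inj₂ (entry p)
  ; instruction = λ { (inj₁ _) → halt ; (inj₂ s) → code p inj₂ (inj₁ tt) s }
  ; input       = i
  ; output      = o
  }

body-time : ∀ B (f : Symbol → Maybe (Program κ)) {p} a → f a ≡ just p →
  time B p ≤ bodyTime B (f (bit true)) + (bodyTime B (f (bit false)) + bodyTime B (f #))
body-time B f (bit true)  fa rewrite fa = m≤m+n _ _
body-time B f (bit false) fa rewrite fa = m≤n⇒m≤o+n (bodyTime B (f (bit true))) (m≤m+n _ _)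
body-time B f #           fa rewrite fa = m≤n⇒m≤o+n (bodyTime B (f (bit true))) (m≤n+m _ _)

module _ (M : Machine) (B : ℕ) where
  open Machine M

  -- A `Run` ends only where the machine halts, so a fragment of a computation is not a `Run`. It is
  -- represented by its effect of prolonging every run that starts where the fragment ends.
  Within : ℕ → Config → Config → Set
  Within T c c′ = ∃[ t ] t ≤ T × (∀ {s d} → Run c′ s d → Run c (t + s) d)

  step-within : ∀ {c c′} → step c ≡ just c′ → Within 1 c c′
  step-within eq = 1 , ≤-refl , next eq

  within-trans : ∀ {T T′ c d e} → Within T c d → Within T′ d e → Within (T + T′) c e
  within-trans {c = c} (t , t≤ , r) (t′ , t′≤ , r′) = t + t′ , +-mono-≤ t≤ t′≤ ,
    λ {s} {f} run → subst (λ n → Run c n f) (sym (+-assoc t t′ s)) (r (r′ run))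

  within-mono : ∀ {T T′ c d} → T ≤ T′ → Within T c d → Within T′ c d
  within-mono T≤ (t , t≤ , r) = t , ≤-trans t≤ T≤ , r

  top≗head : ∀ w → top w ≡ head w
  top≗head []      = refl
  top≗head (_ ∷ _) = refl

  rest≗drop : ∀ w → rest w ≡ drop 1 w
  rest≗drop []      = refl
  rest≗drop (_ ∷ _) = refl

  step-pop : ∀ {q i g m} → instruction q ≡ pop i g → step (q , m) ≡ just (g (head (lookup m i)) , m [ i ]%= drop 1)
  step-pop {i = i} {m = m} eq rewrite eq | top≗head (lookup m i) | updateAt-cong i rest≗drop m = refl

  mutual
    -- The hypothesis locates the code of `p` inside the control of an arbitrary machine. The
    -- induction needs this generality: a part of a program sits in the same machine with another
    -- embedding `ι` and another exit `x`.
    exec-within : ∀ {p : Program stacks} {ι x m n} → (∀ s → instruction (ι s) ≡ code p ι x s) →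
      Exec B p m n → Within (time B p) (ι (entry p) , m) (x , n)
    exec-within {m = m} h push = step-within (cong (λ c → execute c m) (h tt))
    exec-within h (e ⨾ e′) =
      within-trans (exec-within (h ∘ inj₁) e) (exec-within (h ∘ inj₂) e′)
    exec-within h (loop r<B l) = within-mono (*-monoˡ-≤ _ r<B) (loop-within h l)

    loop-within : ∀ {i} {f : Symbol → Maybe (Program stacks)} {r ι x m n} →
      (∀ s → instruction (ι s) ≡ code (loop i f) ι x s) → Loop B i f r m n →
      Within (suc r * suc (bodyTime B (f (bit true)) + (bodyTime B (f (bit false)) + bodyTime B (f #))))
        (ι (inj₁ tt) , m) (x , n)
    loop-within {i} {f} {ι = ι} {x} {m} h (exit stops) =
      within-mono (s≤s z≤n) (step-within (trans (step-pop (h (inj₁ tt)))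
        (cong (λ q → just (q , m [ i ]%= drop 1)) (branch-exit f (ι ∘ inj₂) x (head (lookup m i)) stops))))
    loop-within {i} {f} {ι = ι} {x} h (next {a} {l = l} is-a fa e es) = within-trans
      (within-trans
        (step-within (trans (step-pop (h (inj₁ tt)))
          (cong (λ s → just (branch f (ι ∘ inj₂) x s , l [ i ]%= drop 1)) is-a)))
        (within-mono (body-time B f a fa) (body-within (λ s → h (inj₂ (a , s))) fa e)))
      (loop-within h es)

    body-within : ∀ {b p ι x y m n} → (∀ s → instruction (ι s) ≡ bodyCode b ι y s) → b ≡ just p →
      Exec B p m n → Within (time B p) (continue b ι x , m) (y , n)
    body-within h refl e = exec-within h e

-- The length of the input word serves as the bound `B` on all loops; it has to be positive for the
-- monomial bound to apply.
machine-polynomialTime : ∀ {X Y : Set} (encodeX : X → Word) (encodeY : Y → Word) (f : X → Y)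
  (p : Program κ) (i o : Fin κ) → (∀ x → NonZero (length (encodeX x))) →
  (∀ x → ∃[ m ] Exec (length (encodeX x)) p (Vec.replicate κ [] [ i ]≔ encodeX x) m × lookup m o ≡ encodeY (f x)) →
  PolynomialTime encodeX encodeY f
machine-polynomialTime encodeX encodeY f p i o nonempty runs =
  let c , d , bound = time-polynomial p in machine p i o , c , d , λ x →
    let B              = length (encodeX x)
        m , e , out    = runs x
        t , t≤ , reach = exec-within (machine p i o) B (λ _ → refl) e
    in t + 0
     , ≤-trans (≤-trans (≤-reflexive (+-identityʳ t)) (≤-trans t≤ (bound B {{nonempty x}}))) (m≤m+n _ c)
     , inj₁ tt , m , reach (stop refl) , out
  where open Machine

-- Cycles

module _ {A : Set} {R : A → A → Set} where

  linked-split : ∀ xs {y zs} → Linked R (xs ++ y ∷ zs) → Linked R (xs ∷ʳ y) × Linked R (y ∷ zs)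
  linked-split []           l       = [-] , l
  linked-split (x ∷ [])     (r ∷ l) = r ∷ [-] , l
  linked-split (x ∷ w ∷ xs) (r ∷ l) = let l₁ , l₂ = linked-split (w ∷ xs) l in r ∷ l₁ , l₂

  linked-join : ∀ xs {y zs} → Linked R (xs ∷ʳ y) → Linked R (y ∷ zs) → Linked R (xs ++ y ∷ zs)
  linked-join []           _       l = l
  linked-join (x ∷ [])     (r ∷ _) l = r ∷ l
  linked-join (x ∷ w ∷ xs) (r ∷ k) l = r ∷ linked-join (w ∷ xs) k l

  Cycle : A → List A → Set
  Cycle v vs = 2 ≤ length vs × Unique (v ∷ vs) × Linked R (v ∷ vs ∷ʳ v)

  rotation : ∀ (v : A) xs x ys → v ∷ xs ++ x ∷ ys ↭ x ∷ ys ++ v ∷ xs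
  rotation v xs x ys = ++-comm (v ∷ xs) (x ∷ ys)

  -- Rotation brings any vertex of a cycle to the front, so that neighbours need to be found only
  -- there.
  rotate : ∀ {v} xs {x ys} → Cycle v (xs ++ x ∷ ys) → Cycle x (ys ++ v ∷ xs)
  rotate {v} xs {x} {ys} (long , unique , linked) =
      subst (2 ≤_) (suc-injective (↭-length (rotation v xs x ys))) long
    , Unique-resp-↭ (setoid A) (↭⇒↭ₛ (rotation v xs x ys)) unique
    , subst (Linked R) (cong (x ∷_) (sym (++-assoc ys (v ∷ xs) [ x ])))
        (linked-join (x ∷ ys) (proj₂ halves) (proj₁ halves))
    where
    halves : Linked R (v ∷ xs ∷ʳ x) × Linked R (x ∷ ys ∷ʳ v)
    halves = linked-split (v ∷ xs) (subst (Linked R) (cong (v ∷_) (++-assoc xs (x ∷ ys) [ v ])) linked)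

  TwoNeighbours : A → List A → Set
  TwoNeighbours x xs = ∃₂ λ y z → y List.∈ xs × z List.∈ xs × y ≢ z × R x y × R x z

  -- The neighbours are the second and the last vertex, which differ because a cycle has at least
  -- three vertices, all distinct.
  cycle-start-neighbours : (∀ {x y} → R x y → R y x) → ∀ {v vs} → Cycle v vs → TwoNeighbours v (v ∷ vs)
  cycle-start-neighbours R-sym {v} {w ∷ ws} (long , (_ ∷ (w∉ws ∷ _)) , (vw ∷ linked)) with initLast ws
  cycle-start-neighbours R-sym {v} {w ∷ _} (s≤s () , _) | []
  ... | us ∷ʳ′ u = w , u , there (here refl) , there (there u∈) , All.lookup w∉ws u∈ , vw , R-sym uv
    where
    u∈ : u List.∈ us ∷ʳ u
    u∈ = ∈-++⁺ʳ us (here refl)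
    uv : R u v
    uv = Linked.head (proj₂ (linked-split (w ∷ us) (subst (Linked R) (cong (w ∷_) (++-assoc us [ u ] [ v ])) linked)))

  cycle-neighbours : (∀ {x y} → R x y → R y x) → ∀ {v vs x} → Cycle v vs → x List.∈ v ∷ vs → TwoNeighbours x (v ∷ vs)
  cycle-neighbours R-sym cycle (here refl) = cycle-start-neighbours R-sym cycle
  cycle-neighbours R-sym {v} {x = x} cycle (there x∈) with xs , ys , refl ← ∈-∃++ x∈ =
    let y , z , y∈ , z∈ , rest = cycle-start-neighbours R-sym (rotate xs cycle)
        back = ↭-sym (rotation v xs x ys)
    in y , z , ∈-resp-↭ back y∈ , ∈-resp-↭ back z∈ , rest

-- Subsets

private variable
  a b c : ℕ

-- The elementwise form of `p ≡ ⁅ x ⁆ ∪ ⁅ y ⁆`. Unlike the equation, it is easily carried over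
-- between the vertices of the old graph and their copies in the new one.
IsPair : Subset c → Fin c → Fin c → Set
IsPair p x y = x ∈ p × y ∈ p × (∀ {z} → z ∈ p → z ≡ x ⊎ z ≡ y)

isPair⇒≡ : ∀ {p : Subset c} {x y} → IsPair p x y → p ≡ ⁅ x ⁆ ∪ ⁅ y ⁆
isPair⇒≡ {p = p} {x} {y} (x∈p , y∈p , only) = ⊆-antisym p⊆ ⊆p
  where
  p⊆ : ∀ {z} → z ∈ p → z ∈ ⁅ x ⁆ ∪ ⁅ y ⁆
  p⊆ z∈p with only z∈p
  ... | inj₁ refl = x∈p∪q⁺ (inj₁ (x∈⁅x⁆ x))
  ... | inj₂ refl = x∈p∪q⁺ (inj₂ (x∈⁅x⁆ y))
  ⊆p : ∀ {z} → z ∈ ⁅ x ⁆ ∪ ⁅ y ⁆ → z ∈ p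
  ⊆p z∈ with x∈p∪q⁻ ⁅ x ⁆ ⁅ y ⁆ z∈
  ... | inj₁ z∈x rewrite x∈⁅y⁆⇒x≡y x z∈x = x∈p
  ... | inj₂ z∈y rewrite x∈⁅y⁆⇒x≡y y z∈y = y∈p

≡⇒isPair : ∀ {p : Subset c} {x y} → p ≡ ⁅ x ⁆ ∪ ⁅ y ⁆ → IsPair p x y
≡⇒isPair {x = x} {y} refl = x∈p∪q⁺ (inj₁ (x∈⁅x⁆ x)) , x∈p∪q⁺ (inj₂ (x∈⁅x⁆ y)) , only
  where
  only : ∀ {z} → z ∈ ⁅ x ⁆ ∪ ⁅ y ⁆ → z ≡ x ⊎ z ≡ y
  only z∈ with x∈p∪q⁻ ⁅ x ⁆ ⁅ y ⁆ z∈
  ... | inj₁ z∈x = inj₁ (x∈⁅y⁆⇒x≡y x z∈x)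
  ... | inj₂ z∈y = inj₂ (x∈⁅y⁆⇒x≡y y z∈y)

∣p++q∣≡∣p∣+∣q∣ : ∀ (p : Subset a) (q : Subset b) → ∣ p Vec.++ q ∣ ≡ ∣ p ∣ + ∣ q ∣
∣p++q∣≡∣p∣+∣q∣ []          q = refl
∣p++q∣≡∣p∣+∣q∣ (true ∷ p)  q = cong suc (∣p++q∣≡∣p∣+∣q∣ p q)
∣p++q∣≡∣p∣+∣q∣ (false ∷ p) q = ∣p++q∣≡∣p∣+∣q∣ p q

∈-concat⁺ : ∀ (ps : Vec (Subset b) a) {i x} → x ∈ lookup ps i → combine i x ∈ Vec.concat ps
∈-concat⁺ ps {i} {x} x∈ = lookup⇒[]= _ _ (trans (lookup-concat ps i x) ([]=⇒lookup x∈))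

∈-concat⁻ : ∀ (ps : Vec (Subset b) a) {i x} → combine i x ∈ Vec.concat ps → x ∈ lookup ps i
∈-concat⁻ ps {i} {x} x∈ = lookup⇒[]= _ _ (trans (sym (lookup-concat ps i x)) ([]=⇒lookup x∈))

tabulate-+ : ∀ {A : Set} m (f : Fin (m + c) → A) → Vec.tabulate f ≡ Vec.tabulate (f ∘ (_↑ˡ c)) Vec.++ Vec.tabulate (f ∘ (m ↑ʳ_))
tabulate-+ zero    f = refl
tabulate-+ (suc m) f = cong (f zero ∷_) (tabulate-+ m (f ∘ suc))

tabulate-const : ∀ {A : Set} n (x : A) → Vec.tabulate {n = n} (λ _ → x) ≡ Vec.replicate n x
tabulate-const zero    x = refl
tabulate-const (suc n) x = cong (x ∷_) (tabulate-const n x)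

data Combined {a b : ℕ} : Fin (a * b) → Set where
  combined : ∀ i x → Combined (combine {a} {b} i x)

decombine : ∀ {a b} (z : Fin (a * b)) → Combined {a} z
decombine {a} {b} z = subst Combined (combine-remQuot {a} b z) (uncurry combined (remQuot {a} b z))

-- The reduction

-- Layer 0 carries the original graph.  On the three copies of a vertex v
-- sits a triangle, whose edge of kind k avoids layer k.
Layer : Set
Layer = Fin 3

pattern l₀ = zero
pattern l₁ = suc zero
pattern l₂ = suc (suc zero)

other-layer : ∀ (i j : Layer) → ∃ λ k → k ≢ i × k ≢ j
other-layer = toWitness {a? = all? λ i → all? λ j → any? λ k → ¬? (k ≟ i) ×-dec ¬? (k ≟ j)} _

only-two : ∀ (i j k l : Layer) → i ≢ j → i ≢ k → j ≢ k → l ≢ k → l ≡ i ⊎ l ≡ j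
only-two = toWitness {a? = all? λ i → all? λ j → all? λ k → all? λ l →
  ¬? (i ≟ j) →-dec ¬? (i ≟ k) →-dec ¬? (j ≟ k) →-dec ¬? (l ≟ k) →-dec (l ≟ i ⊎-dec l ≟ j)} _

module Reduction (I : MDSTInstance) where
  open MDSTInstance I renaming (order to n; size to m)

  copy : Layer → Vertex → Fin (3 * n)
  copy = combine

  Edge′ : Set
  Edge′ = Fin (m + 3 * n)

  original : Edge → Edge′
  original = _↑ˡ 3 * n

  gadget : Layer → Vertex → Edge′
  gadget k v = m ↑ʳ combine k v

  data EdgeView : Edge′ → Set where
    is-original : ∀ e → EdgeView (original e)
    is-gadget   : ∀ k v → EdgeView (gadget k v)

  view : ∀ x → EdgeView x
  view x with splitAt m x in eq
  ... | inj₁ e = subst EdgeView (splitAt⁻¹-↑ˡ eq) (is-original e)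
  ... | inj₂ y with decombine {3} {n} y
  ... | combined k v = subst EdgeView (splitAt⁻¹-↑ʳ eq) (is-gadget k v)

  edgeCase : ∀ {A : Set} → (Edge → A) → (Layer → Vertex → A) → Edge′ → A
  edgeCase f g x = [ f , uncurry g ∘ remQuot n ]′ (splitAt m x)

  edgeCase-original : ∀ {A : Set} (f : Edge → A) g e → edgeCase f g (original e) ≡ f e
  edgeCase-original f g e rewrite splitAt-↑ˡ m e (3 * n) = refl

  edgeCase-gadget : ∀ {A : Set} (f : Edge → A) g k v → edgeCase f g (gadget k v) ≡ g k v
  edgeCase-gadget f g k v rewrite splitAt-↑ʳ m (3 * n) (combine k v) =
    cong (uncurry g) (remQuot-combine k v)

  -- The edges of the new graph

  originalEnds : Edge → Vec (Subset n) 3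
  originalEnds e = ends e ∷ ⊥ ∷ ⊥ ∷ []

  gadgetEnds : Layer → Vertex → Vec (Subset n) 3
  gadgetEnds k v = Vec.replicate 3 ⁅ v ⁆ [ k ]≔ ⊥

  ends′ : Edge′ → Subset (3 * n)
  ends′ = edgeCase (Vec.concat ∘ originalEnds) (λ k v → Vec.concat (gadgetEnds k v))

  ends′-original : ∀ e → ends′ (original e) ≡ Vec.concat (originalEnds e)
  ends′-original = edgeCase-original (Vec.concat ∘ originalEnds) (λ k v → Vec.concat (gadgetEnds k v))

  ends′-gadget : ∀ k v → ends′ (gadget k v) ≡ Vec.concat (gadgetEnds k v)
  ends′-gadget = edgeCase-gadget (Vec.concat ∘ originalEnds) (λ k v → Vec.concat (gadgetEnds k v))

  ∈-original⁺ : ∀ e {v} → v ∈ ends e → copy l₀ v ∈ ends′ (original e)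
  ∈-original⁺ e {v} v∈ = subst (copy l₀ v ∈_) (sym (ends′-original e)) (∈-concat⁺ (originalEnds e) {l₀} v∈)

  ∈-original⁻ : ∀ e i {v} → copy i v ∈ ends′ (original e) → i ≡ l₀ × v ∈ ends e
  ∈-original⁻ e i {v} v∈ = at i (∈-concat⁻ (originalEnds e) {i} (subst (copy i v ∈_) (ends′-original e) v∈))
    where
    at : ∀ i {v} → v ∈ lookup (originalEnds e) i → i ≡ l₀ × v ∈ ends e
    at l₀ v∈ = refl , v∈
    at l₁ v∈ = Empty.⊥-elim (∉⊥ v∈)
    at l₂ v∈ = Empty.⊥-elim (∉⊥ v∈)

  ∈-gadget⁺ : ∀ {k} i v → i ≢ k → copy i v ∈ ends′ (gadget k v)
  ∈-gadget⁺ {k} i v i≢k = subst (copy i v ∈_) (sym (ends′-gadget k v))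
    (∈-concat⁺ (gadgetEnds k v) (subst (v ∈_) (sym eq) (x∈⁅x⁆ v)))
    where
    eq : lookup (gadgetEnds k v) i ≡ ⁅ v ⁆
    eq = trans (lookup∘update′ i≢k (Vec.replicate 3 ⁅ v ⁆) ⊥) (lookup-replicate i ⁅ v ⁆)

  ∈-gadget⁻ : ∀ k v i {w} → copy i w ∈ ends′ (gadget k v) → i ≢ k × w ≡ v
  ∈-gadget⁻ k v i {w} w∈ = i≢k , x∈⁅y⁆⇒x≡y v (subst (w ∈_) eq w∈i)
    where
    w∈i : w ∈ lookup (gadgetEnds k v) i
    w∈i = ∈-concat⁻ (gadgetEnds k v) {i} (subst (copy i w ∈_) (ends′-gadget k v) w∈)
    i≢k : i ≢ k
    i≢k refl = ∉⊥ (subst (w ∈_) (lookup∘update k (Vec.replicate 3 ⁅ v ⁆) ⊥) w∈i)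
    eq : lookup (gadgetEnds k v) i ≡ ⁅ v ⁆
    eq = trans (lookup∘update′ i≢k (Vec.replicate 3 ⁅ v ⁆) ⊥) (lookup-replicate i ⁅ v ⁆)

  ∣concat∣ : ∀ (p q r : Subset n) → ∣ Vec.concat (p ∷ q ∷ r ∷ []) ∣ ≡ ∣ p ∣ + (∣ q ∣ + ∣ r ∣)
  ∣concat∣ p q r
    rewrite ∣p++q∣≡∣p∣+∣q∣ p (Vec.concat (q ∷ r ∷ [])) | ∣p++q∣≡∣p∣+∣q∣ q (Vec.concat (r ∷ []))
          | ∣p++q∣≡∣p∣+∣q∣ r [] | +-identityʳ ∣ r ∣ = refl

  ∣gadget∣ : ∀ k v → ∣ Vec.concat (gadgetEnds k v) ∣ ≡ 2
  ∣gadget∣ l₀ v rewrite ∣concat∣ ⊥ ⁅ v ⁆ ⁅ v ⁆ | ∣⊥∣≡0 n | ∣⁅x⁆∣≡1 v = refl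
  ∣gadget∣ l₁ v rewrite ∣concat∣ ⁅ v ⁆ ⊥ ⁅ v ⁆ | ∣⊥∣≡0 n | ∣⁅x⁆∣≡1 v = refl
  ∣gadget∣ l₂ v rewrite ∣concat∣ ⁅ v ⁆ ⁅ v ⁆ ⊥ | ∣⊥∣≡0 n | ∣⁅x⁆∣≡1 v = refl

  ends′-two : ∀ x → ∣ ends′ x ∣ ≡ 2
  ends′-two x with view x
  ... | is-original e rewrite ends′-original e
                         | ∣concat∣ (ends e) ⊥ ⊥ | ∣⊥∣≡0 n | +-identityʳ ∣ ends e ∣ = ends-two e
  ... | is-gadget k v rewrite ends′-gadget k v = ∣gadget∣ k v

  -- A gadget edge has ends in two layers, hence one outside layer 0.
  original≢gadget : ∀ e k v → ends′ (original e) ≢ ends′ (gadget k v)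
  original≢gadget e k v eq with j , j≢0 , j≢k ← other-layer l₀ k =
    j≢0 (proj₁ (∈-original⁻ e j (subst (copy j v ∈_) (sym eq) (∈-gadget⁺ j v j≢k))))

  -- The kind is the layer that the edge avoids, and the vertex can be read off either of the other
  -- layers.
  gadget-injective : ∀ k v l w → ends′ (gadget k v) ≡ ends′ (gadget l w) → gadget k v ≡ gadget l w
  gadget-injective k v l w eq with k ≟ l
  ... | no k≢l = contradiction refl (proj₁ (∈-gadget⁻ l w l (subst (copy l v ∈_) eq (∈-gadget⁺ l v (k≢l ∘ sym)))))
  ... | yes refl with j , j≢k , _ ← other-layer k k =
    cong (gadget k) (proj₂ (∈-gadget⁻ k w j (subst (copy j v ∈_) eq (∈-gadget⁺ j v j≢k))))

  ends′-injective : ∀ {x y} → ends′ x ≡ ends′ y → x ≡ y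
  ends′-injective {x} {y} eq with view x | view y
  ... | is-original e | is-gadget k v   = Empty.⊥-elim (original≢gadget e k v eq)
  ... | is-gadget k v | is-original e   = Empty.⊥-elim (original≢gadget e k v (sym eq))
  ... | is-gadget k v | is-gadget l w   = gadget-injective k v l w eq
  ... | is-original e | is-original e′ = cong original (ends-injective (++-injectiveˡ (ends e) (ends e′)
    (trans (sym (ends′-original e)) (trans eq (ends′-original e′)))))

  graph′ : Graph
  graph′ = record
    { order          = 3 * n
    ; size           = m + 3 * n
    ; ends           = ends′
    ; ends-two       = ends′-two
    ; ends-injective = ends′-injective
    }

  -- The dependency digraph and the bounds

  -- Columns: the original edges, then the gadget edges of kinds 0, 1 and 2.
  originalArcs : Edge → Vec Bool (m + 3 * n)
  originalArcs e = ⊥ {m} Vec.++ Vec.concat (⊥ ∷ ends e ∷ ends e ∷ [])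

  -- Row `x` marks the edges that depend on `x`, so `dep` reads columns. Arcs lead from original to
  -- gadget edges only, which makes the digraph loopless.
  arcs : Edge′ → Vec Bool (m + 3 * n)
  arcs = edgeCase originalArcs (λ _ _ → ⊥)

  arcs-original : ∀ e → arcs (original e) ≡ originalArcs e
  arcs-original = edgeCase-original originalArcs (λ _ _ → ⊥)

  arcs-gadget : ∀ k v → arcs (gadget k v) ≡ ⊥
  arcs-gadget = edgeCase-gadget originalArcs (λ _ _ → ⊥)

  lookup-⊥ : ∀ {k} x → lookup (⊥ {k}) x ≡ false
  lookup-⊥ x = lookup-replicate x false

  dependency′ : Digraph (m + 3 * n)
  dependency′ = record { arc = lookup ∘ arcs ; loopless = loopless′ }
    where
    loopless′ : ∀ x → lookup (arcs x) x ≡ false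
    loopless′ x with view x
    ... | is-original e = trans (cong (λ r → lookup r (original e)) (arcs-original e))
                        (trans (lookup-++ˡ ⊥ _ e) (lookup-⊥ e))
    ... | is-gadget k v = trans (cong (λ r → lookup r (gadget k v)) (arcs-gadget k v)) (lookup-⊥ (gadget k v))

  -- Kind 2, the edge between layers 0 and 1, carries the bounds of `v`; kind 1, between layers 0
  -- and 2, tests for a leaf. Kind 0 depends on nothing, so that both bounds 0 leave it free.
  gadgetBound : (Vertex → ℕ) → Layer → Vertex → ℕ
  gadgetBound β l₀ v = 0
  gadgetBound β l₁ v = 1
  gadgetBound β l₂ v = β v

  bound′ : (Vertex → ℕ) → Edge′ → ℕ
  bound′ β = edgeCase (λ _ → 0) (gadgetBound β)

  instance′ : DCSTInstance
  instance′ = record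
    { graph      = graph′
    ; dependency = dependency′
    ; ℓ          = bound′ ℓ
    ; u          = bound′ u
    }

  module ′ = DCSTInstance instance′

  restrict : ′.EdgeSet → EdgeSet
  restrict H = Vec.tabulate (lookup H ∘ original)

  ∈-restrict⁺ : ∀ {H e} → original e ∈ H → e ∈ restrict H
  ∈-restrict⁺ {H} {e} e∈ = lookup⇒[]= e _ (trans (lookup∘tabulate _ e) ([]=⇒lookup e∈))

  ∈-restrict⁻ : ∀ {H e} → e ∈ restrict H → original e ∈ H
  ∈-restrict⁻ {H} {e} e∈ = lookup⇒[]= _ H (trans (sym (lookup∘tabulate _ e)) ([]=⇒lookup e∈))

  dependents : Layer → Vertex → EdgeSet
  dependents l₀ v = ⊥
  dependents l₁ v = incident v
  dependents l₂ v = incident v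

  dep-original : ∀ e → ′.dep (original e) ≡ ⊥
  dep-original e = trans (Vec.tabulate-cong column) (tabulate-const _ false)
    where
    column : ∀ x → lookup (arcs x) (original e) ≡ false
    column x with view x
    ... | is-original e′ = trans (cong (λ r → lookup r (original e)) (arcs-original e′))
                         (trans (lookup-++ˡ ⊥ _ e) (lookup-⊥ e))
    ... | is-gadget k v  = trans (cong (λ r → lookup r (original e)) (arcs-gadget k v)) (lookup-⊥ (original e))

  dep-gadget : ∀ k v → ′.dep (gadget k v) ≡ dependents k v Vec.++ ⊥
  dep-gadget k v = trans (tabulate-+ m _) (cong₂ Vec._++_ (here-column k) there-column)
    where
    blocks : Edge → Vec (Subset n) 3
    blocks e = ⊥ ∷ ends e ∷ ends e ∷ []

    arc-entry : ∀ e k → lookup (arcs (original e)) (gadget k v) ≡ lookup (lookup (blocks e) k) v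
    arc-entry e k = trans (cong (λ r → lookup r (gadget k v)) (arcs-original e))
      (trans (lookup-++ʳ (⊥ {m}) _ (combine k v)) (lookup-concat (blocks e) k v))

    here-column : ∀ k → Vec.tabulate (λ e → lookup (arcs (original e)) (gadget k v)) ≡ dependents k v
    here-column l₀ = trans (Vec.tabulate-cong λ e → trans (arc-entry e l₀) (lookup-⊥ v)) (tabulate-const m false)
    here-column l₁ = Vec.tabulate-cong λ e → arc-entry e l₁
    here-column l₂ = Vec.tabulate-cong λ e → arc-entry e l₂

    zero-column : ∀ y → lookup (arcs (m ↑ʳ y)) (gadget k v) ≡ false
    zero-column y with combined l w ← decombine {3} {n} y =
      trans (cong (λ r → lookup r (gadget k v)) (arcs-gadget l w)) (lookup-⊥ (gadget k v))

    there-column : Vec.tabulate (λ y → lookup (arcs (m ↑ʳ y)) (gadget k v)) ≡ ⊥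
    there-column = trans (Vec.tabulate-cong zero-column) (tabulate-const _ false)

  ∣⊥∩p∣≡0 : ∀ {k} (p : Subset k) → ∣ ⊥ ∩ p ∣ ≡ 0
  ∣⊥∩p∣≡0 {k} p = trans (cong ∣_∣ (∩-zeroˡ p)) (∣⊥∣≡0 k)

  load-original : ∀ H e → ∣ ′.dep (original e) ∩ H ∣ ≡ 0
  load-original H e rewrite dep-original e = ∣⊥∩p∣≡0 H

  -- No edge depends on a gadget edge, so only the restriction of `H` counts. For kinds 1 and 2 the
  -- right-hand side is `degree (restrict H) v` by definition.
  load-gadget : ∀ H k v → ∣ ′.dep (gadget k v) ∩ H ∣ ≡ ∣ dependents k v ∩ restrict H ∣
  load-gadget H k v = begin
    ∣ ′.dep (gadget k v) ∩ H ∣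
      ≡⟨ cong₂ (λ p q → ∣ p ∩ q ∣) (dep-gadget k v) (trans (sym (tabulate∘lookup H)) (tabulate-+ m (lookup H))) ⟩
    ∣ (dependents k v Vec.++ ⊥) ∩ (restrict H Vec.++ H″) ∣
      ≡⟨ cong ∣_∣ (zipWith-++ _ (dependents k v) ⊥ (restrict H) H″) ⟩
    ∣ (dependents k v ∩ restrict H) Vec.++ (⊥ ∩ H″) ∣
      ≡⟨ ∣p++q∣≡∣p∣+∣q∣ (dependents k v ∩ restrict H) (⊥ ∩ H″) ⟩
    ∣ dependents k v ∩ restrict H ∣ + ∣ ⊥ ∩ H″ ∣
      ≡⟨ cong (∣ dependents k v ∩ restrict H ∣ +_) (∣⊥∩p∣≡0 H″) ⟩
    ∣ dependents k v ∩ restrict H ∣ + 0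
      ≡⟨ +-identityʳ _ ⟩
    ∣ dependents k v ∩ restrict H ∣ ∎
    where
    open ≡-Reasoning
    H″ : Subset (3 * n)
    H″ = Vec.tabulate (lookup H ∘ (m ↑ʳ_))

  -- Adjacency in the new graph

  adjacent-sym : ∀ {H x y} → ′.Adjacent H x y → ′.Adjacent H y x
  adjacent-sym {x = x} {y} (e , e∈ , eq) = e , e∈ , trans eq (∪-comm ⁅ x ⁆ ⁅ y ⁆)

  adjacent-original : ∀ {H v w} → Adjacent (restrict H) v w → ′.Adjacent H (copy l₀ v) (copy l₀ w)
  adjacent-original {H} {v} {w} (e , e∈ , eq) = original e , ∈-restrict⁻ e∈ , isPair⇒≡ (lift (≡⇒isPair eq))
    where
    lift : IsPair (ends e) v w → IsPair (ends′ (original e)) (copy l₀ v) (copy l₀ w)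
    lift (v∈ , w∈ , only) = ∈-original⁺ e v∈ , ∈-original⁺ e w∈ , only′
      where
      only′ : ∀ {z} → z ∈ ends′ (original e) → z ≡ copy l₀ v ⊎ z ≡ copy l₀ w
      only′ {z} z∈ with combined i y ← decombine {3} {n} z with refl , y∈ ← ∈-original⁻ e i z∈ with only y∈
      ... | inj₁ refl = inj₁ refl
      ... | inj₂ refl = inj₂ refl

  adjacent-gadget : ∀ {H} i j k v → gadget k v ∈ H → i ≢ j → i ≢ k → j ≢ k → ′.Adjacent H (copy i v) (copy j v)
  adjacent-gadget {H} i j k v g∈ i≢j i≢k j≢k = gadget k v , g∈ ,
    isPair⇒≡ (∈-gadget⁺ i v i≢k , ∈-gadget⁺ j v j≢k , only)
    where
    only : ∀ {z} → z ∈ ends′ (gadget k v) → z ≡ copy i v ⊎ z ≡ copy j v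
    only {z} z∈ with combined l y ← decombine {3} {n} z with l≢k , refl ← ∈-gadget⁻ k v l z∈ with only-two i j k l i≢j i≢k j≢k l≢k
    ... | inj₁ refl = inj₁ refl
    ... | inj₂ refl = inj₂ refl

  -- The converse of `adjacent-original` and `adjacent-gadget`. Layers and vertices are indices, so
  -- that matching on a step settles them: an original edge stays in layer 0, a gadget edge keeps
  -- the vertex.
  data Step (H : ′.EdgeSet) : Layer → Vertex → Layer → Vertex → Set where
    along-original : ∀ {v w} → Adjacent (restrict H) v w → Step H l₀ v l₀ w
    along-gadget   : ∀ {i j} k v → gadget k v ∈ H → i ≢ j → i ≢ k → j ≢ k → Step H i v j v

  step : ∀ {H} i v j w → ′.Adjacent H (copy i v) (copy j w) → Step H i v j w
  step {H} i v j w (x , x∈ , eq) with view x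
  ... | is-original e = from-original (≡⇒isPair eq)
    where
    from-original : IsPair (ends′ (original e)) (copy i v) (copy j w) → Step H i v j w
    from-original (v∈ , w∈ , only) with refl , v∈e ← ∈-original⁻ e i v∈ | refl , w∈e ← ∈-original⁻ e j w∈ =
      along-original (e , ∈-restrict⁺ x∈ , isPair⇒≡ (v∈e , w∈e , only′))
      where
      only′ : ∀ {z} → z ∈ ends e → z ≡ v ⊎ z ≡ w
      only′ {z} z∈ with only (∈-original⁺ e z∈)
      ... | inj₁ eq = inj₁ (proj₂ (combine-injective {3} l₀ z l₀ v eq))
      ... | inj₂ eq = inj₂ (proj₂ (combine-injective {3} l₀ z l₀ w eq))
  ... | is-gadget k c = from-gadget (≡⇒isPair eq)
    where
    from-gadget : IsPair (ends′ (gadget k c)) (copy i v) (copy j w) → Step H i v j w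
    from-gadget (v∈ , w∈ , only) with i≢k , refl ← ∈-gadget⁻ k c i v∈ | j≢k , refl ← ∈-gadget⁻ k c j w∈ =
      along-gadget k c x∈ i≢j i≢k j≢k
      where
      i≢j : i ≢ j
      -- Two ends in layer `i` would leave out the end of the gadget edge in the layer `l` other
      -- than `k` and `i`.
      i≢j refl with l , l≢k , l≢i ← other-layer k i with only (∈-gadget⁺ l c l≢k)
      ... | inj₁ eq = l≢i (proj₁ (combine-injective l c i c eq))
      ... | inj₂ eq = l≢i (proj₁ (combine-injective l c i c eq))

  bound-original : ∀ β e → bound′ β (original e) ≡ 0
  bound-original β = edgeCase-original (λ _ → 0) (gadgetBound β)

  bound-gadget : ∀ β k v → bound′ β (gadget k v) ≡ gadgetBound β k v
  bound-gadget β = edgeCase-gadget (λ _ → 0) (gadgetBound β)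

  -- `copy l₀` is injective and preserves adjacency, so it carries cycles to cycles.
  acyclic-restrict : ∀ {H} → ′.Acyclic H → Acyclic (restrict H)
  acyclic-restrict {H} acyclic v vs (long , unique , linked) = acyclic (copy l₀ v) (List.map (copy l₀) vs)
    ( subst (2 ≤_) (sym (length-map (copy l₀) vs)) long
    , Unique.map⁺ (λ {x} {y} eq → proj₂ (combine-injective {3} l₀ x l₀ y eq)) unique
    , subst (λ ws → Linked (′.Adjacent H) (copy l₀ v ∷ ws)) (map-++ (copy l₀) vs [ v ])
        (Linked.map⁺ (Linked.map (adjacent-original {H}) linked)))

  -- From a solution of the new instance to one of the old

  module Backward {T′ : ′.EdgeSet} (tree : ′.IsSpanningTree T′) (satisfies : ′.Satisfies T′) where

    -- Contracting each triangle to its vertex turns paths into paths: steps along original edges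
    -- survive, steps along gadget edges vanish. The endpoints are given by equations because the
    -- inner vertices of a path become copies only when decomposed.
    project : ∀ {x y} → Star (′.Adjacent T′) x y → ∀ i v j w → x ≡ copy i v → y ≡ copy j w →
              Star (Adjacent (restrict T′)) v w
    project ε i v j w refl eq with refl ← proj₂ (combine-injective {3} i v j w eq) = ε
    project (_◅_ {j = y} s ss) i v j w refl eq with combined k c ← decombine {3} {n} y with step i v k c s
    ... | along-original a         = a ◅ project ss k c j w refl eq
    ... | along-gadget _ _ _ _ _ _ = project ss k c j w refl eq

    connected : Connected (restrict T′)
    connected = nonempty n (proj₁ (proj₁ tree)) ,
      λ v w → project (proj₂ (proj₁ tree) (copy l₀ v) (copy l₀ w)) l₀ v l₀ w refl refl
      where
      nonempty : ∀ n → NonZero (3 * n) → NonZero n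
      nonempty zero    nz = nz
      nonempty (suc _) _  = _

    -- Layer 0 is reached from the other copies of `v` only by kinds 1 and 2. Without these, a path
    -- from such a copy can move only along kind 0, between layers 1 and 2.
    detached : ∀ {v x y} → gadget l₁ v ∉ T′ → gadget l₂ v ∉ T′ → Star (′.Adjacent T′) x y →
               ∀ i → x ≡ copy i v → i ≢ l₀ → ∃ λ j → y ≡ copy j v × j ≢ l₀
    detached no₁ no₂ ε i eq i≢0 = i , eq , i≢0
    detached {v} no₁ no₂ (_◅_ {j = y} s ss) i refl i≢0 with combined j w ← decombine {3} {n} y with step i v j w s
    ... | along-original _                   = contradiction refl i≢0
    ... | along-gadget l₀ _ g∈ _ _ j≢0       = detached no₁ no₂ ss j refl j≢0
    ... | along-gadget l₁ _ g∈ _ _ _         = contradiction g∈ no₁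
    ... | along-gadget l₂ _ g∈ _ _ _         = contradiction g∈ no₂

    gadget-bounds : ∀ k v → gadget k v ∈ T′ →
      gadgetBound ℓ k v ≤ ∣ dependents k v ∩ restrict T′ ∣ × ∣ dependents k v ∩ restrict T′ ∣ ≤ gadgetBound u k v
    gadget-bounds k v g∈ with lower , upper ← satisfies (gadget k v) g∈ =
        subst₂ _≤_ (bound-gadget ℓ k v) (load-gadget T′ k v) lower
      , subst₂ _≤_ (load-gadget T′ k v) (bound-gadget u k v) upper

    -- Kind 2 in the tree gives the bounds of `v`, and kind 1 makes `v` a leaf. One of them is
    -- present, since otherwise `copy l₁ v` would be cut off from `copy l₀ v`.
    bounds : ∀ v → ¬ IsLeaf (restrict T′) v → ℓ v ≤ degree (restrict T′) v × degree (restrict T′) v ≤ u v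
    bounds v internal with gadget l₂ v ∈? T′ | gadget l₁ v ∈? T′
    ... | yes g∈ | _      = gadget-bounds l₂ v g∈
    ... | no _   | yes g∈ = let 1≤d , d≤1 = gadget-bounds l₁ v g∈ in contradiction (≤-antisym d≤1 1≤d) internal
    ... | no no₂ | no no₁ with detached no₁ no₂ (proj₂ (proj₁ tree) (copy l₁ v) (copy l₀ v)) l₁ refl (λ ())
    ... | j , eq , j≢0 = contradiction (sym (proj₁ (combine-injective {3} l₀ v j v eq))) j≢0

    solution : Solvable
    solution = restrict T′ , (connected , acyclic-restrict (proj₂ tree)) , bounds

  -- From a solution of the old instance to one of the new

  module Forward {T : EdgeSet} (tree : IsSpanningTree T)
                 (bounds : ∀ v → ¬ IsLeaf T v → ℓ v ≤ degree T v × degree T v ≤ u v) where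

    isLeaf : Vertex → Bool
    isLeaf v = degree T v ℕ.≡ᵇ 1

    attachment : Layer → Vertex → Bool
    attachment l₀ v = true
    attachment l₁ v = isLeaf v
    attachment l₂ v = not (isLeaf v)

    T′ : ′.EdgeSet
    T′ = Vec.tabulate (edgeCase (lookup T) attachment)

    restrict-T′ : restrict T′ ≡ T
    restrict-T′ = trans (Vec.tabulate-cong λ e → trans (lookup∘tabulate _ (original e)) (edgeCase-original (lookup T) attachment e))
                        (tabulate∘lookup T)

    lookup-gadget : ∀ k v → lookup T′ (gadget k v) ≡ attachment k v
    lookup-gadget k v = trans (lookup∘tabulate _ (gadget k v)) (edgeCase-gadget (lookup T) attachment k v)

    gadget∈⁺ : ∀ k v → attachment k v ≡ true → gadget k v ∈ T′
    gadget∈⁺ k v eq = lookup⇒[]= _ T′ (trans (lookup-gadget k v) eq)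

    gadget∈⁻ : ∀ k v → gadget k v ∈ T′ → attachment k v ≡ true
    gadget∈⁻ k v g∈ = trans (sym (lookup-gadget k v)) ([]=⇒lookup g∈)

    home : ∀ i v → Star (′.Adjacent T′) (copy i v) (copy l₀ v)
    home i v with isLeaf v in leaf
    home l₀ v | _     = ε
    -- The two chosen edges form a path through the layers 1, 2, 0 if `v` is a leaf, and through 2,
    -- 1, 0 otherwise.
    home l₁ v | true  = adjacent-gadget l₁ l₂ l₀ v (gadget∈⁺ l₀ v refl) (λ ()) (λ ()) (λ ())
                      ◅ adjacent-gadget l₂ l₀ l₁ v (gadget∈⁺ l₁ v leaf) (λ ()) (λ ()) (λ ()) ◅ ε
    home l₂ v | true  = adjacent-gadget l₂ l₀ l₁ v (gadget∈⁺ l₁ v leaf) (λ ()) (λ ()) (λ ()) ◅ ε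
    home l₁ v | false = adjacent-gadget l₁ l₀ l₂ v (gadget∈⁺ l₂ v (cong not leaf)) (λ ()) (λ ()) (λ ()) ◅ ε
    home l₂ v | false = adjacent-gadget l₂ l₁ l₀ v (gadget∈⁺ l₀ v refl) (λ ()) (λ ()) (λ ())
                      ◅ adjacent-gadget l₁ l₀ l₂ v (gadget∈⁺ l₂ v (cong not leaf)) (λ ()) (λ ()) (λ ()) ◅ ε

    connected : ′.Connected T′
    connected = nonempty n (proj₁ (proj₁ tree)) , joined
      where
      nonempty : ∀ n → NonZero n → NonZero (3 * n)
      nonempty (suc _) _ = _
      joined : ∀ x y → Star (′.Adjacent T′) x y
      joined x y with combined i v ← decombine {3} {n} x | combined j w ← decombine {3} {n} y =
        home i v
        ◅◅ gmap (copy l₀) (adjacent-original {T′})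
             (subst (λ H → Star (Adjacent H) v w) (sym restrict-T′) (proj₂ (proj₁ tree) v w))
        ◅◅ Star.reverse (adjacent-sym {T′}) (home j w)

    -- Kinds 1 and 2 are chosen by complementary tests. The symmetric form serves at a copy whose
    -- outer layer is not known.
    exclusive : ∀ i j v → i ≢ l₀ → j ≢ l₀ → i ≢ j → gadget i v ∈ T′ → gadget j v ∉ T′
    exclusive l₀ _  v i≢0 _ _ _ _ = i≢0 refl
    exclusive l₁ l₀ v _ j≢0 _ _ _ = j≢0 refl
    exclusive l₂ l₀ v _ j≢0 _ _ _ = j≢0 refl
    exclusive l₁ l₁ v _ _ i≢j _ _ = i≢j refl
    exclusive l₂ l₂ v _ _ i≢j _ _ = i≢j refl
    exclusive l₁ l₂ v _ _ _ g∈ h∈ with () ← trans (sym (cong not (gadget∈⁻ l₁ v g∈))) (gadget∈⁻ l₂ v h∈)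
    exclusive l₂ l₁ v _ _ _ g∈ h∈ with () ← trans (sym (cong not (gadget∈⁻ l₁ v h∈))) (gadget∈⁻ l₂ v g∈)

    module _ {c cs} (cycle : ′.IsCycle T′ c cs) where

      -- Both neighbours of a copy of v outside layer 0 lie in the triangle
      -- of v, so that the cycle uses both edges at this copy.
      triangle : ∀ i v j → i ≢ l₀ → i ≢ j → copy i v List.∈ c ∷ cs → copy j v List.∈ c ∷ cs × gadget j v ∈ T′
      triangle i v j i≢0 i≢j v∈ with cycle-neighbours (adjacent-sym {T′}) cycle v∈
      ... | y , z , y∈ , z∈ , y≢z , vy , vz
        with combined a p ← decombine {3} {n} y | combined b q ← decombine {3} {n} z
        with step i v a p vy | step i v b q vz
      ... | along-original _ | _ = contradiction refl i≢0
      ... | along-gadget _ _ _ _ _ _ | along-original _ = contradiction refl i≢0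
      ... | along-gadget k _ k∈ i≢a i≢k a≢k | along-gadget l _ l∈ i≢b i≢l b≢l = at-copy , at-gadget
        where
        a≢b : a ≢ b
        a≢b refl = y≢z refl
        at-copy : copy j v List.∈ c ∷ cs
        at-copy with only-two a b i j a≢b (i≢a ∘ sym) (i≢b ∘ sym) (i≢j ∘ sym)
        ... | inj₁ refl = y∈
        ... | inj₂ refl = z∈
        at-gadget : gadget j v ∈ T′
        at-gadget with only-two k l i j k≢l (i≢k ∘ sym) (i≢l ∘ sym) (i≢j ∘ sym)
          where
          k≢l : k ≢ l
          -- If `k` were `l`, then `i`, `k` and `b` would be all the layers, leaving none for `a`.
          k≢l refl with only-two i k b a i≢k i≢b (b≢l ∘ sym) a≢b
          ... | inj₁ a≡i = i≢a (sym a≡i)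
          ... | inj₂ a≡k = a≢k a≡k
        ... | inj₁ refl = k∈
        ... | inj₂ refl = l∈

      -- A cycle through `copy i v` outside layer 0 uses both triangle edges there, of kind 0 and of
      -- kind `j`, where `j` is the other outer layer. The former leads to `copy j v`, where the
      -- edge of kind `i` is used as well; but only one of kinds 1 and 2 was chosen.
      at-ground : ∀ {x} → x List.∈ c ∷ cs → ∃ λ v → x ≡ copy l₀ v
      at-ground {x} x∈ with combined i v ← decombine {3} {n} x with i ≟ l₀
      ... | yes refl = v , refl
      ... | no i≢0 with j , j≢i , j≢0 ← other-layer i l₀ with j∈ , gⱼ∈ ← triangle i v j i≢0 (j≢i ∘ sym) x∈ =
        contradiction gⱼ∈ (exclusive i j v i≢0 j≢0 (j≢i ∘ sym) (proj₂ (triangle j v i j≢0 j≢i j∈)))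

    ground : ∀ xs → (∀ {x} → x List.∈ xs → ∃ λ v → x ≡ copy l₀ v) → ∃ λ vs → xs ≡ List.map (copy l₀) vs
    ground []       _  = [] , refl
    ground (x ∷ xs) at with v , refl ← at (here refl) | vs , refl ← ground xs (at ∘ there) = v ∷ vs , refl

    acyclic : ′.Acyclic T′
    acyclic c cs cycle with ground (c ∷ cs) (at-ground cycle)
    acyclic _ _ (long , unique , linked) | v ∷ vs , refl = proj₂ tree v vs
      ( subst (2 ≤_) (length-map (copy l₀) vs) long
      , Unique.map⁻ unique
      , Linked.map ground-step (Linked.map⁻ (subst (λ ws → Linked (′.Adjacent T′) (copy l₀ v ∷ ws))
          (sym (map-++ (copy l₀) vs [ v ])) linked)))
      where
      ground-step : ∀ {v w} → ′.Adjacent T′ (copy l₀ v) (copy l₀ w) → Adjacent T v w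
      ground-step {v} {w} vw with step l₀ v l₀ w vw
      ... | along-original a           = subst (λ H → Adjacent H v w) restrict-T′ a
      ... | along-gadget _ _ _ 0≢0 _ _ = contradiction refl 0≢0

    within-bounds : ∀ k v → gadget k v ∈ T′ →
      gadgetBound ℓ k v ≤ ∣ dependents k v ∩ T ∣ × ∣ dependents k v ∩ T ∣ ≤ gadgetBound u k v
    within-bounds l₀ v _ = z≤n , ≤-reflexive (∣⊥∩p∣≡0 T)
    within-bounds l₁ v g∈ = ≤-reflexive (sym leaf) , ≤-reflexive leaf
      where
      leaf : IsLeaf T v
      leaf = ≡ᵇ⇒≡ (degree T v) 1 (Equivalence.from T-≡ (gadget∈⁻ l₁ v g∈))
    within-bounds l₂ v g∈ = bounds v internal
      where
      internal : ¬ IsLeaf T v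
      internal leaf with () ← trans (sym (cong not (Equivalence.to T-≡ (≡⇒≡ᵇ (degree T v) 1 leaf)))) (gadget∈⁻ l₂ v g∈)

    satisfies : ′.Satisfies T′
    satisfies x x∈ with view x
    ... | is-original e = subst₂ _≤_ (sym (bound-original ℓ e)) (sym (load-original T′ e)) z≤n
                        , subst₂ _≤_ (sym (load-original T′ e)) (sym (bound-original u e)) z≤n
    ... | is-gadget k v with lower , upper ← within-bounds k v x∈ =
      let load = sym (trans (load-gadget T′ k v) (cong (λ H → ∣ dependents k v ∩ H ∣) restrict-T′))
      in subst₂ _≤_ (sym (bound-gadget ℓ k v)) load lower , subst₂ _≤_ load (sym (bound-gadget u k v)) upper

    solution : ′.Solvable
    solution = T′ , (connected , acyclic) , satisfies

  correct : Solvable ⇔ ′.Solvable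
  correct = mk⇔ (λ (T , tree , bounds) → Forward.solution tree bounds)
                (λ (T′ , tree , satisfies) → Backward.solution tree satisfies)

-- The program

-- The input, the output, unary counters for the vertices and (twice) for
-- the edges, three copies of the incidence matrix, two scratch stacks.
pattern inp = zero
pattern out = suc zero
pattern #V  = suc (suc zero)
pattern #E  = suc (suc (suc zero))
pattern #E′ = suc (suc (suc (suc zero)))
pattern R₁  = suc (suc (suc (suc (suc zero))))
pattern R₂  = suc (suc (suc (suc (suc (suc zero)))))
pattern R₃  = suc (suc (suc (suc (suc (suc (suc zero))))))
pattern S   = suc (suc (suc (suc (suc (suc (suc (suc zero)))))))
pattern T   = suc (suc (suc (suc (suc (suc (suc (suc (suc zero))))))))

pattern 𝟎 = bit false
pattern 𝟏 = bit true

Prog : Set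
Prog = Program 10

memory : (i o v e e′ r₁ r₂ r₃ s t : Word) → Stacks 10
memory i o v e e′ r₁ r₂ r₃ s t = i ∷ o ∷ v ∷ e ∷ e′ ∷ r₁ ∷ r₂ ∷ r₃ ∷ s ∷ t ∷ []

always onBit onOne : (Symbol → Prog) → Symbol → Maybe Prog
always p a          = just (p a)
onBit p (bit b)     = just (p (bit b))
onBit p #           = nothing
onOne p (bit true)  = just (p 𝟏)
onOne p (bit false) = nothing
onOne p #           = nothing

-- p extends the push that ends each iteration.  As every program has an
-- instruction, this is how p can be trivial.
forEach : Fin 10 → Fin 10 → (Prog → Prog) → Prog
forEach x y p = loop x (always λ _ → p (push y 𝟏)) ⨾ loop y (always λ _ → push x 𝟏)

-- Everything is emitted backwards, since words are read from the top.
emit : Word → Prog → Prog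
emit w p = foldr (λ a q → q ⨾ push out a) p w

-- The scratch stack `T` differs from the `S` of the enclosing loops, so that this can be nested in
-- them. Inside a loop over `#E′`, the second counter `#E` still holds one symbol per edge.
emitEach : Fin 10 → Word → Prog
emitEach x w = forEach x T (emit w)

-- A row ends up reversed on its stack with `#` below it, and the last row on top. As the output is
-- built from its end, popping the rows restores both orders.
readRow : Prog
readRow = push R₁ # ⨾ push R₂ # ⨾ push R₃ # ⨾ loop inp (onBit λ a → push R₁ a ⨾ push R₂ a ⨾ push R₃ a)

emitRow : Fin 10 → Prog
emitRow r = loop r (onBit (push out))

parse : Prog
parse = loop inp (onOne λ _ → push #V 𝟏)
      ⨾ loop inp (onOne λ _ → push #E 𝟏 ⨾ push #E′ 𝟏)
      ⨾ forEach #E′ S (readRow ⨾_)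
      -- The rest of the input encodes the bounds of the vertices. Moved through `T` to keep its
      -- order, it becomes the end of the output: the bounds of the edges of kind 2.
      ⨾ loop inp (always (push T))
      ⨾ loop T (always (push out))

emitBounds : Prog
emitBounds = emitEach #V (binary 1 ++ binary 1)
           ⨾ emitEach #V (binary 0 ++ binary 0)
           ⨾ emitEach #E (binary 0 ++ binary 0)

-- Emits the characteristic vector of the current vertex of a loop over
-- #V with scratch stack S if a is 𝟏, and zeros if a is 𝟎.
emitBlock : Symbol → Prog
emitBlock a = emitEach S [ 𝟎 ] ⨾ push out a ⨾ emitEach #V [ 𝟎 ]

emitBlocks : Symbol → Symbol → Symbol → Prog
emitBlocks a b c = push out # ⨾ emitBlock c ⨾ emitBlock b ⨾ emitBlock a

emitGadgetArcs : Prog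
emitGadgetArcs = forEach #V S ((emitBlocks 𝟎 𝟎 𝟎 ⨾ emitEach #E [ 𝟎 ]) ⨾_)

emitDigraph : Prog
emitDigraph = emitGadgetArcs ⨾ emitGadgetArcs ⨾ emitGadgetArcs
            ⨾ forEach #E′ S ((push out # ⨾ emitRow R₂ ⨾ emitRow R₃ ⨾ emitEach #V [ 𝟎 ] ⨾ emitEach #E [ 𝟎 ]) ⨾_)

emitGraph : Prog
emitGraph = forEach #V S (emitBlocks 𝟏 𝟏 𝟎 ⨾_)
          ⨾ forEach #V S (emitBlocks 𝟏 𝟎 𝟏 ⨾_)
          ⨾ forEach #V S (emitBlocks 𝟎 𝟏 𝟏 ⨾_)
          ⨾ forEach #E′ S ((push out # ⨾ emitEach #V [ 𝟎 ] ⨾ emitEach #V [ 𝟎 ] ⨾ emitRow R₁) ⨾_)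
          -- The header, backwards: the size `m + 3 * n`, then the order `3 * n`, for `n` vertices
          -- and `m` edges.
          ⨾ push out # ⨾ emitEach #V [ 𝟏 ] ⨾ emitEach #V [ 𝟏 ] ⨾ emitEach #V [ 𝟏 ] ⨾ emitEach #E [ 𝟏 ]
          ⨾ push out # ⨾ emitEach #V [ 𝟏 ] ⨾ emitEach #V [ 𝟏 ] ⨾ emitEach #V [ 𝟏 ]

program : Prog
program = parse ⨾ emitBounds ⨾ emitDigraph ⨾ emitGraph

-- Words

ones : ℕ → Word
ones j = List.replicate j 𝟏

repeat : ℕ → Word → Word
repeat j w = concat (List.replicate j w)

zeros : ℕ → Word
zeros j = repeat j [ 𝟎 ]

-- A row made of one block per layer for the vertex with p vertices before
-- and q vertices after it.
block : Symbol → ℕ → ℕ → Word → Word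
block a p q o = zeros p ++ (a ∷ (zeros q ++ o))

blocks : Symbol → Symbol → Symbol → ℕ → ℕ → Word → Word
blocks a b c p q o = block a p q (block b p q (block c p q (# ∷ o)))

-- The rows of the vertices p, p + 1, …, p + q - 1 of p + q.
rowsFrom : (ℕ → ℕ → Word → Word) → ℕ → ℕ → Word → Word
rowsFrom row p zero    o = o
rowsFrom row p (suc q) o = row p q (rowsFrom row (suc p) q o)

bitWord : List Bool → Word
bitWord = List.map bit

bitWord-reverse-ʳ++ : ∀ (bs : List Bool) o → bitWord (reverse bs) ʳ++ o ≡ bitWord bs ++ o
bitWord-reverse-ʳ++ bs o = begin
  bitWord (reverse bs) ʳ++ o              ≡⟨ ʳ++-defn (bitWord (reverse bs)) ⟩
  reverse (bitWord (reverse bs)) ++ o     ≡⟨ cong (_++ o) (reverse-map bit (reverse bs)) ⟨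
  bitWord (reverse (reverse bs)) ++ o     ≡⟨ cong (λ cs → bitWord cs ++ o) (reverse-involutive bs) ⟩
  bitWord bs ++ o                         ∎
  where open ≡-Reasoning

bitWord-ʳ++ : ∀ (bs : List Bool) o → bitWord bs ʳ++ o ≡ bitWord (reverse bs) ++ o
bitWord-ʳ++ bs o = trans (ʳ++-defn (bitWord bs)) (cong (_++ o) (sym (reverse-map bit bs)))

-- Execution of loops on ten stacks

module Semantics (B : ℕ) where

  push! : ∀ {i a} {m m′ : Stacks 10} → m [ i ]%= (a ∷_) ≡ m′ → Exec B (push i a) m m′
  push! refl = push

  exec-from : ∀ {p} {l m n : Stacks 10} → l ≡ m → Exec B p m n → Exec B p l n
  exec-from refl e = e

  exec-to : ∀ {p} {l m n : Stacks 10} → m ≡ n → Exec B p l m → Exec B p l n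
  exec-to refl e = e

  loop-to : ∀ {i f r} {l m n : Stacks 10} → m ≡ n → Loop B i f r l m → Loop B i f r l n
  loop-to refl e = e

  -- `σ` is a memory with the contents of the stacks `X` and `Y` left open. For concrete stacks the
  -- equations hold by computation; assuming them treats each kind of loop once for all stacks.
  record Holes (X Y : Fin 10) (σ : Word → Word → Stacks 10) : Set where
    field
      lookup-X : ∀ {x y} → lookup (σ x y) X ≡ x
      lookup-Y : ∀ {x y} → lookup (σ x y) Y ≡ y
      update-X : ∀ {x y} f → σ x y [ X ]%= f ≡ σ (f x) y
      update-Y : ∀ {x y} f → σ x y [ Y ]%= f ≡ σ x (f y)

  module _ {X Y : Fin 10} where
    open Holes

    loop-exit : ∀ {σ f y} → Holes X Y σ → Loop B X f 0 (σ [] y) (σ [] y)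
    loop-exit {σ} {f} {y} h = loop-to (update-X h (drop 1))
      (exit (cong (λ l → head l >>= f) (lookup-X h)))

    loop-next : ∀ {σ p r x y m n} → Holes X Y σ → Exec B p (σ x y) m → Loop B X (always λ _ → p) r m n →
                Loop B X (always λ _ → p) (suc r) (σ (𝟏 ∷ x) y) n
    loop-next h e = next (cong head (lookup-X h)) refl (exec-from (update-X h (drop 1)) e)

  swap : ∀ {X Y σ} → Holes X Y σ → Holes Y X (λ y x → σ x y)
  swap h = record { lookup-X = lookup-Y ; lookup-Y = lookup-X ; update-X = update-Y ; update-Y = update-X }
    where open Holes h

  module _ {X Y : Fin 10} where
    open Holes

    move-back : ∀ {σ} → Holes X Y σ → ∀ j x → Loop B Y (always λ _ → (push X 𝟏)) j (σ (ones x) (ones j)) (σ (ones (j + x)) [])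
    move-back {σ} h zero    x = loop-exit (swap h)
    move-back {σ} h (suc j) x = loop-to (cong (λ k → σ (ones k) []) (+-suc j x))
      (loop-next (swap h) (push! (update-X h (𝟏 ∷_))) (move-back h j (suc x)))

    exec-back : ∀ {σ} → Holes X Y σ → ∀ {j} → j < B → Exec B (loop Y (always λ _ → push X 𝟏)) (σ [] (ones j)) (σ (ones j) [])
    exec-back {σ} h {j} j<B = loop j<B
      (loop-to (cong (λ k → σ (ones k) []) (+-identityʳ j)) (move-back h j 0))

    -- p iterations remain and q are done.
    exec-forEach : ∀ {n} body (P : ℕ → ℕ → Word → Word → Stacks 10) → (∀ p q → Holes X Y (P p q)) →
      (∀ p q → suc p + q ≡ n → Exec B (body (push Y 𝟏)) (P (suc p) q (ones p) (ones q)) (P p (suc q) (ones p) (ones (suc q)))) →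
      n < B → Exec B (forEach X Y body) (P n 0 (ones n) []) (P 0 n (ones n) [])
    exec-forEach {n} body P holes exec-body n<B = loop n<B (go n 0 (+-identityʳ n)) ⨾ exec-back (holes 0 n) n<B
      where
      go : ∀ p q → p + q ≡ n → Loop B X (always λ _ → (body (push Y 𝟏))) p (P p q (ones p) (ones q)) (P 0 n [] (ones n))
      go zero    q refl = loop-exit (holes 0 q)
      go (suc p) q eq   = loop-next (holes (suc p) q) (exec-body p q eq) (go p (suc q) (trans (+-suc p q) eq))

    -- For loops that process a list along with the counter: `xs` is what remains of it, `acc` what
    -- has been built so far.
    exec-forEach-list : ∀ {A Acc : Set} {body} (P : List A → Acc → Word → Word → Stacks 10) (f : Acc → A → Acc) →
      (∀ xs acc → Holes X Y (P xs acc)) →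
      (∀ x xs acc k s → Exec B body (P (x ∷ xs) acc k s) (P xs (f acc x) k s)) →
      ∀ xs acc → length xs < B →
      Exec B (forEach X Y (body ⨾_)) (P xs acc (ones (length xs)) []) (P [] (foldl f acc xs) (ones (length xs)) [])
    exec-forEach-list {body = body} P f holes exec-body xs acc len<B = loop len<B
      (loop-to (cong (λ k → P [] (foldl f acc xs) [] (ones k)) (+-identityʳ (length xs))) (go xs acc 0))
      ⨾ exec-back (holes [] _) len<B
      where
      go : ∀ xs acc s → Loop B X (always λ _ → (body ⨾ push Y 𝟏)) (length xs)
             (P xs acc (ones (length xs)) (ones s)) (P [] (foldl f acc xs) [] (ones (length xs + s)))
      go []       acc s = loop-exit (holes [] acc)
      go (x ∷ xs) acc s = loop-to (cong (λ k → P [] (foldl f acc (x ∷ xs)) [] (ones k)) (+-suc (length xs) s))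
        (loop-next (holes (x ∷ xs) acc) (exec-body x xs acc _ _ ⨾ push! (update-Y (holes xs _) (𝟏 ∷_))) (go xs (f acc x) (suc s)))

    exec-emitEach : ∀ {j o} w (σ : Word → Word → Word → Stacks 10) → (∀ {o} → Holes X Y (σ o)) → (∀ {o x y} f → σ o x y [ out ]%= f ≡ σ (f o) x y) →
      j < B → Exec B (forEach X Y (emit w)) (σ o (ones j) []) (σ (repeat j w ++ o) (ones j) [])
    exec-emitEach {o = o} w σ holes update-out = exec-forEach (emit w) (λ p q → σ (repeat q w ++ o)) (λ _ _ → holes) λ p q _ →
      exec-to (cong (λ o′ → σ o′ (ones p) (ones (suc q))) (sym (++-assoc w (repeat q w) o)))
        (exec-emit w (push! (update-Y holes (𝟏 ∷_))))
      where
      exec-emit : ∀ {p m x y o} w → Exec B p m (σ o x y) → Exec B (emit w p) m (σ (w ++ o) x y)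
      exec-emit []      e = e
      exec-emit (a ∷ w) e = exec-emit w e ⨾ push! (update-out (a ∷_))

  private variable
    i o v e k r₁ r₂ r₃ s t : Word

  emitEach-V : ∀ w {j} → j < B → Exec B (emitEach #V w)
    (memory i o (ones j) e k r₁ r₂ r₃ s []) (memory i (repeat j w ++ o) (ones j) e k r₁ r₂ r₃ s [])
  emitEach-V {i} {o} {e} {k} {r₁} {r₂} {r₃} {s} w = exec-emitEach w (λ o v t → memory i o v e k r₁ r₂ r₃ s t)
    (record { lookup-X = refl ; lookup-Y = refl ; update-X = λ _ → refl ; update-Y = λ _ → refl }) (λ _ → refl)

  emitEach-E : ∀ w {j} → j < B → Exec B (emitEach #E w)
    (memory i o v (ones j) k r₁ r₂ r₃ s []) (memory i (repeat j w ++ o) v (ones j) k r₁ r₂ r₃ s [])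
  emitEach-E {i} {o} {v} {k} {r₁} {r₂} {r₃} {s} w = exec-emitEach w (λ o e t → memory i o v e k r₁ r₂ r₃ s t)
    (record { lookup-X = refl ; lookup-Y = refl ; update-X = λ _ → refl ; update-Y = λ _ → refl }) (λ _ → refl)

  emitEach-S : ∀ w {j} → j < B → Exec B (emitEach S w)
    (memory i o v e k r₁ r₂ r₃ (ones j) []) (memory i (repeat j w ++ o) v e k r₁ r₂ r₃ (ones j) [])
  emitEach-S {i} {o} {v} {e} {k} {r₁} {r₂} {r₃} w = exec-emitEach w (λ o s t → memory i o v e k r₁ r₂ r₃ s t)
    (record { lookup-X = refl ; lookup-Y = refl ; update-X = λ _ → refl ; update-Y = λ _ → refl }) (λ _ → refl)

  exec-blocks : ∀ a b c {p q} → p < B → q < B → Exec B (emitBlocks a b c)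
    (memory i o (ones p) e k r₁ r₂ r₃ (ones q) []) (memory i (blocks a b c p q o) (ones p) e k r₁ r₂ r₃ (ones q) [])
  exec-blocks a b c {p} {q} p<B q<B = push ⨾ exec-block c ⨾ exec-block b ⨾ exec-block a
    where
    exec-block : ∀ a → Exec B (emitBlock a)
      (memory i o (ones p) e k r₁ r₂ r₃ (ones q) []) (memory i (block a p q o) (ones p) e k r₁ r₂ r₃ (ones q) [])
    exec-block a = emitEach-S [ 𝟎 ] q<B ⨾ push ⨾ emitEach-V [ 𝟎 ] p<B

  -- The loop runs from the last vertex to the first. When `p` ones remain on `#V` and `q` have gone
  -- to `S`, the current vertex has `p` vertices before and `q` after it, and the rows of the latter
  -- are already emitted.
  exec-rows : ∀ {body n} (row : ℕ → ℕ → Word → Word) →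
    (∀ {o} p q → p < B → q < B → Exec B body (memory i o (ones p) e k r₁ r₂ r₃ (ones q) [])
                                             (memory i (row p q o) (ones p) e k r₁ r₂ r₃ (ones q) [])) →
    n < B → Exec B (forEach #V S (body ⨾_))
      (memory i o (ones n) e k r₁ r₂ r₃ [] []) (memory i (rowsFrom row 0 n o) (ones n) e k r₁ r₂ r₃ [] [])
  exec-rows {i} {e} {k} {r₁} {r₂} {r₃} {o} {body} {n} row exec-row n<B =
    exec-forEach (body ⨾_) (λ p q v s → memory i (rowsFrom row p q o) v e k r₁ r₂ r₃ s [])
      (λ _ _ → record { lookup-X = refl ; lookup-Y = refl ; update-X = λ _ → refl ; update-Y = λ _ → refl })
      (λ p q eq → exec-row p q
        (≤-<-trans (≤-trans (n≤1+n p) (≤-trans (m≤m+n (suc p) q) (≤-reflexive eq))) n<B)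
        (≤-<-trans (≤-trans (m≤n+m q (suc p)) (≤-reflexive eq)) n<B) ⨾ push)
      n<B

  exec-emitRow : ∀ {r σ} → Holes r out σ → ∀ {x o} bs → length bs < B → Exec B (emitRow r)
    (σ (bitWord (reverse bs) ++ # ∷ x) o) (σ x (bitWord bs ++ o))
  exec-emitRow {r} {σ} holes {x} {o} bs len<B = loop (subst (_< B) (sym (length-reverse bs)) len<B)
    (loop-to (cong (σ x) (bitWord-reverse-ʳ++ bs o)) (go (reverse bs)))
    where
    open Holes holes
    go : ∀ {o} bs → Loop B r (onBit (push out)) (length bs) (σ (bitWord bs ++ # ∷ x) o) (σ x (bitWord bs ʳ++ o))
    go []       = loop-to (update-X (drop 1)) (exit (cong (λ l → head l >>= onBit (push out)) lookup-X))
    go (b ∷ bs) = next (cong head lookup-X) refl (exec-from (update-X (drop 1)) (push! (update-Y (bit b ∷_)))) (go bs)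

  exec-readRow : ∀ bs → length bs < B → Exec B readRow
    (memory (bitWord bs ++ # ∷ i) o v e k r₁ r₁ r₁ s t)
    (let r = bitWord (reverse bs) ++ # ∷ r₁ in memory i o v e k r r r s t)
  exec-readRow {i} {o} {v} {e} {k} {r₁} {s} {t} bs len<B = push ⨾ push ⨾ push ⨾ loop len<B
    (loop-to (cong (λ r → memory i o v e k r r r s t) (bitWord-ʳ++ bs (# ∷ r₁))) (go bs))
    where
    go : ∀ {r} bs → Loop B inp (onBit λ a → push R₁ a ⨾ push R₂ a ⨾ push R₃ a) (length bs) (memory (bitWord bs ++ # ∷ i) o v e k r r r s t)
      (let r′ = bitWord bs ʳ++ r in memory i o v e k r′ r′ r′ s t)
    go []       = exit refl
    go (b ∷ bs) = next refl refl (push ⨾ push ⨾ push) (go bs)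

  exec-readV : ∀ n → n < B → Exec B (loop inp (onOne λ _ → push #V 𝟏))
    (memory (ones n ++ # ∷ i) o [] e k r₁ r₂ r₃ s t) (memory i o (ones n) e k r₁ r₂ r₃ s t)
  exec-readV {i} {o} {e} {k} {r₁} {r₂} {r₃} {s} {t} n n<B = loop n<B
    (loop-to (cong (λ j → memory i o (ones j) e k r₁ r₂ r₃ s t) (+-identityʳ n)) (go n 0))
    where
    go : ∀ j l → Loop B inp (onOne λ _ → push #V 𝟏) j (memory (ones j ++ # ∷ i) o (ones l) e k r₁ r₂ r₃ s t) (memory i o (ones (j + l)) e k r₁ r₂ r₃ s t)
    go zero    l = exit refl
    go (suc j) l = loop-to (cong (λ j → memory i o (ones j) e k r₁ r₂ r₃ s t) (+-suc j l)) (next refl refl push (go j (suc l)))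

  exec-readE : ∀ m → m < B → Exec B (loop inp (onOne λ _ → push #E 𝟏 ⨾ push #E′ 𝟏))
    (memory (ones m ++ # ∷ i) o v [] [] r₁ r₂ r₃ s t) (memory i o v (ones m) (ones m) r₁ r₂ r₃ s t)
  exec-readE {i} {o} {v} {r₁} {r₂} {r₃} {s} {t} m m<B = loop m<B
    (loop-to (cong (λ j → memory i o v (ones j) (ones j) r₁ r₂ r₃ s t) (+-identityʳ m)) (go m 0))
    where
    go : ∀ j l → Loop B inp (onOne λ _ → push #E 𝟏 ⨾ push #E′ 𝟏) j (memory (ones j ++ # ∷ i) o v (ones l) (ones l) r₁ r₂ r₃ s t) (memory i o v (ones (j + l)) (ones (j + l)) r₁ r₂ r₃ s t)
    go zero    l = exit refl
    go (suc j) l = loop-to (cong (λ j → memory i o v (ones j) (ones j) r₁ r₂ r₃ s t) (+-suc j l)) (next refl refl (push ⨾ push) (go j (suc l)))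

  exec-copyRest : ∀ w → length w < B → Exec B (loop inp (always (push T)) ⨾ loop T (always (push out)))
    (memory w [] v e k r₁ r₂ r₃ s []) (memory [] w v e k r₁ r₂ r₃ s [])
  exec-copyRest {v} {e} {k} {r₁} {r₂} {r₃} {s} w len<B =
      loop len<B (unload w [])
    ⨾ loop (subst (_< B) (sym (length-reverse w)) len<B)
        (loop-to (cong (λ o → memory [] o v e k r₁ r₂ r₃ s []) (trans (ʳ++-ʳ++ w) (++-identityʳ w))) (reload (w ʳ++ []) []))
    where
    unload : ∀ w t → Loop B inp (always (push T)) (length w) (memory w [] v e k r₁ r₂ r₃ s t) (memory [] [] v e k r₁ r₂ r₃ s (w ʳ++ t))
    unload []      t = exit refl
    unload (a ∷ w) t = next refl refl push (unload w (a ∷ t))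
    reload : ∀ w o → Loop B T (always (push out)) (length w) (memory [] o v e k r₁ r₂ r₃ s w) (memory [] (w ʳ++ o) v e k r₁ r₂ r₃ s [])
    reload []      o = exit refl
    reload (a ∷ w) o = next refl refl push (reload w (a ∷ o))

-- Input and output as words

module Output {n : ℕ} where

  Row : Set
  Row = Vec Bool n

  -- Words take their continuation as an argument, which fits an input consumed and an output
  -- extended at the front.
  rowsThen : List Row → Word → Word
  rowsThen rs w = foldr (λ r i → bitWord (toList r) ++ # ∷ i) w rs

  pile : Row → Word → Word
  pile r x = bitWord (reverse (toList r)) ++ # ∷ x

  originalRow : Row → Word → Word
  originalRow r o = bitWord (toList r) ++ (zeros n ++ (zeros n ++ (# ∷ o)))

  triple : Word → Word
  triple o = repeat n [ 𝟏 ] ++ (repeat n [ 𝟏 ] ++ (repeat n [ 𝟏 ] ++ o))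

  module _ (m : ℕ) where

    originalArcsRow : Row → Word → Word
    originalArcsRow r o = zeros m ++ (zeros n ++ (bitWord (toList r) ++ (bitWord (toList r) ++ (# ∷ o))))

    gadgetArcsRow : ℕ → ℕ → Word → Word
    gadgetArcsRow p q o = zeros m ++ blocks 𝟎 𝟎 𝟎 p q o

    boundsThen : Word → Word
    boundsThen o = repeat m (binary 0 ++ binary 0) ++ (repeat n (binary 0 ++ binary 0) ++ (repeat n (binary 1 ++ binary 1) ++ o))

    digraphThen : List Row → Word → Word
    digraphThen rs o = foldr originalArcsRow
      (rowsFrom gadgetArcsRow 0 n (rowsFrom gadgetArcsRow 0 n (rowsFrom gadgetArcsRow 0 n o))) rs

    matrixThen : List Row → Word → Word
    matrixThen rs o = foldr originalRow
      (rowsFrom (blocks 𝟎 𝟏 𝟏) 0 n (rowsFrom (blocks 𝟏 𝟎 𝟏) 0 n (rowsFrom (blocks 𝟏 𝟏 𝟎) 0 n o))) rs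

    headerThen : Word → Word
    headerThen o = triple (# ∷ (repeat m [ 𝟏 ] ++ triple (# ∷ o)))

  module Correctness {B} (n<B : n < B) where
    open Semantics B

    private variable
      i o v e k r₁ r₂ r₃ s t w : Word

    row<B : ∀ (r : Row) → length (toList r) < B
    row<B r = subst (_< B) (sym (length-toList r)) n<B

    piled : List Row → Word
    piled = foldr pile []

    exec-readRows : ∀ rs → length rs < B → Exec B (forEach #E′ S (readRow ⨾_))
      (memory (rowsThen rs w) o v e (ones (length rs)) [] [] [] [] t)
      (let x = piled (reverse rs) in memory w o v e (ones (length rs)) x x x [] t)
    exec-readRows {w} {o} {v} {e} {t} rs len<B = exec-to
      (cong (λ x → memory w o v e (ones (length rs)) x x x [] t) (sym (reverse-foldr pile [] rs)))
      (exec-forEach-list (λ rs x k s → memory (rowsThen rs w) o v e k x x x s t) (λ x r → pile r x)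
        (λ _ _ → record { lookup-X = refl ; lookup-Y = refl ; update-X = λ _ → refl ; update-Y = λ _ → refl })
        (λ r rs x k s → exec-readRow (toList r) (row<B r)) rs [] len<B)

    module _ {rows : List Row} (m<B : length rows < B) where

      m : ℕ
      m = length rows

      exec-parse : length w < B → Exec B parse
        (memory (ones n ++ # ∷ (ones m ++ # ∷ rowsThen rows w)) [] [] [] [] [] [] [] [] [])
        (let x = piled (reverse rows) in memory [] w (ones n) (ones m) (ones m) x x x [] [])
      exec-parse {w} len<B = exec-readV n n<B ⨾ exec-readE m m<B ⨾ exec-readRows rows m<B ⨾ exec-copyRest w len<B

      exec-emitBounds : Exec B emitBounds
        (memory [] o (ones n) (ones m) k r₁ r₂ r₃ s []) (memory [] (boundsThen m o) (ones n) (ones m) k r₁ r₂ r₃ s [])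
      exec-emitBounds = emitEach-V (binary 1 ++ binary 1) n<B ⨾ emitEach-V (binary 0 ++ binary 0) n<B ⨾ emitEach-E (binary 0 ++ binary 0) m<B

      exec-emitGadgetArcs : Exec B emitGadgetArcs
        (memory [] o (ones n) (ones m) k r₁ r₂ r₃ [] [])
        (memory [] (rowsFrom (gadgetArcsRow m) 0 n o) (ones n) (ones m) k r₁ r₂ r₃ [] [])
      exec-emitGadgetArcs = exec-rows (gadgetArcsRow m)
        (λ p q p<B q<B → exec-blocks 𝟎 𝟎 𝟎 p<B q<B ⨾ emitEach-E [ 𝟎 ] m<B) n<B

      -- The rows are visited from the last to the first, and a left fold over the reversed list is
      -- the right fold over `rows`.
      exec-backwards : ∀ {body} (P : List Row → Word → Word → Word → Stacks 10) f → (∀ rs o → Holes #E′ S (P rs o)) →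
        (∀ r rs o k s → Exec B body (P (r ∷ rs) o k s) (P rs (f r o) k s)) →
        Exec B (forEach #E′ S (body ⨾_)) (P (reverse rows) o (ones m) []) (P [] (foldr f o rows) (ones m) [])
      exec-backwards {o} P f holes exec-body =
        exec-from (cong (λ l → P (reverse rows) o (ones l) []) (sym (length-reverse rows)))
          (exec-to (cong₂ (λ o l → P [] o (ones l) []) (reverse-foldl (λ o r → f r o) o rows) (length-reverse rows))
            (exec-forEach-list P (λ o r → f r o) holes exec-body (reverse rows) o
              (subst (_< B) (sym (length-reverse rows)) m<B)))

      exec-emitDigraph : Exec B emitDigraph
        (let x = piled (reverse rows) in memory [] o (ones n) (ones m) (ones m) r₁ x x [] [])
        (memory [] (digraphThen m rows o) (ones n) (ones m) (ones m) r₁ [] [] [] [])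
      exec-emitDigraph {r₁ = r₁} = exec-emitGadgetArcs ⨾ exec-emitGadgetArcs ⨾ exec-emitGadgetArcs
        ⨾ exec-backwards (λ rs o k s → memory [] o (ones n) (ones m) k r₁ (piled rs) (piled rs) s []) (originalArcsRow m)
            (λ _ _ → record { lookup-X = refl ; lookup-Y = refl ; update-X = λ _ → refl ; update-Y = λ _ → refl })
            (λ r rs o k s → push
              ⨾ exec-emitRow {σ = λ x o → memory [] o (ones n) (ones m) k r₁ x (piled (r ∷ rs)) s []}
                  (record { lookup-X = refl ; lookup-Y = refl ; update-X = λ _ → refl ; update-Y = λ _ → refl }) (toList r) (row<B r)
              ⨾ exec-emitRow {σ = λ x o → memory [] o (ones n) (ones m) k r₁ (piled rs) x s []}
                  (record { lookup-X = refl ; lookup-Y = refl ; update-X = λ _ → refl ; update-Y = λ _ → refl }) (toList r) (row<B r)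
              ⨾ emitEach-V [ 𝟎 ] n<B ⨾ emitEach-E [ 𝟎 ] m<B)

      exec-emitGraph : Exec B emitGraph
        (memory [] o (ones n) (ones m) (ones m) (piled (reverse rows)) r₂ r₃ [] [])
        (memory [] (headerThen m (matrixThen m rows o)) (ones n) (ones m) (ones m) [] r₂ r₃ [] [])
      exec-emitGraph {r₂ = r₂} {r₃ = r₃} =
          exec-rows (blocks 𝟏 𝟏 𝟎) (λ p q p<B q<B → exec-blocks 𝟏 𝟏 𝟎 p<B q<B) n<B
        ⨾ exec-rows (blocks 𝟏 𝟎 𝟏) (λ p q p<B q<B → exec-blocks 𝟏 𝟎 𝟏 p<B q<B) n<B
        ⨾ exec-rows (blocks 𝟎 𝟏 𝟏) (λ p q p<B q<B → exec-blocks 𝟎 𝟏 𝟏 p<B q<B) n<B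
        ⨾ exec-backwards (λ rs o k s → memory [] o (ones n) (ones m) k (piled rs) r₂ r₃ s []) originalRow
            (λ _ _ → record { lookup-X = refl ; lookup-Y = refl ; update-X = λ _ → refl ; update-Y = λ _ → refl })
            (λ r rs o k s → push ⨾ emitEach-V [ 𝟎 ] n<B ⨾ emitEach-V [ 𝟎 ] n<B
              ⨾ exec-emitRow {σ = λ x o → memory [] o (ones n) (ones m) k x r₂ r₃ s []}
                  (record { lookup-X = refl ; lookup-Y = refl ; update-X = λ _ → refl ; update-Y = λ _ → refl }) (toList r) (row<B r))
        ⨾ push ⨾ ones-V ⨾ ones-V ⨾ ones-V ⨾ emitEach-E [ 𝟏 ] m<B
        ⨾ push ⨾ ones-V ⨾ ones-V ⨾ ones-V
        where
        ones-V : Exec B (emitEach #V [ 𝟏 ]) (memory i o (ones n) e k r₁ r₂ r₃ s []) (memory i (repeat n [ 𝟏 ] ++ o) (ones n) e k r₁ r₂ r₃ s [])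
        ones-V = emitEach-V [ 𝟏 ] n<B

      exec-program : length w < B → Exec B program
        (memory (ones n ++ # ∷ (ones m ++ # ∷ rowsThen rows w)) [] [] [] [] [] [] [] [] [])
        (memory [] (headerThen m (matrixThen m rows (digraphThen m rows (boundsThen m w)))) (ones n) (ones m) (ones m) [] [] [] [] [])
      exec-program len<B = exec-parse len<B ⨾ exec-emitBounds ⨾ exec-emitDigraph ⨾ exec-emitGraph

-- The encodings

bitsThen : ∀ {l} → Vec Bool l → Word → Word
bitsThen p o = bitWord (toList p) ++ o

bits-++ : ∀ {l} (p : Vec Bool l) o → bits p ++ o ≡ bitsThen p (# ∷ o)
bits-++ p o = ++-assoc (bitWord (toList p)) [ # ] o

bitsThen-++ : ∀ {k l} (p : Vec Bool k) (q : Vec Bool l) o → bitsThen (p Vec.++ q) o ≡ bitsThen p (bitsThen q o)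
bitsThen-++ []      q o = refl
bitsThen-++ (b ∷ p) q o = cong (bit b ∷_) (bitsThen-++ p q o)

bitsThen-concat : ∀ {l} (p q r : Vec Bool l) o →
  bitsThen (Vec.concat (p ∷ q ∷ r ∷ [])) o ≡ bitsThen p (bitsThen q (bitsThen r o))
bitsThen-concat p q r o = trans (bitsThen-++ p _ o) (cong (bitsThen p)
  (trans (bitsThen-++ q _ o) (cong (bitsThen q) (bitsThen-++ r [] o))))

zeros-⊥ : ∀ n o → zeros n ++ o ≡ bitsThen (⊥ {n}) o
zeros-⊥ zero    o = refl
zeros-⊥ (suc n) o = cong (𝟎 ∷_) (zeros-⊥ n o)

block-⁅⁆ : ∀ {n} (v : Fin n) o → block 𝟏 (toℕ v) (n ∸ suc (toℕ v)) o ≡ bitsThen ⁅ v ⁆ o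
block-⁅⁆ {suc n} zero    o = cong (𝟏 ∷_) (zeros-⊥ n o)
block-⁅⁆ {suc n} (suc v) o = cong (𝟎 ∷_) (block-⁅⁆ v o)

block-⊥ : ∀ {n} (v : Fin n) o → block 𝟎 (toℕ v) (n ∸ suc (toℕ v)) o ≡ bitsThen (⊥ {n}) o
block-⊥ {suc n} zero    o = cong (𝟎 ∷_) (zeros-⊥ n o)
block-⊥ {suc n} (suc v) o = cong (𝟎 ∷_) (block-⊥ v o)

blocks-bits : ∀ {n} a b c (p q r : Vec Bool n) (v : Fin n) →
  (∀ o → block a (toℕ v) (n ∸ suc (toℕ v)) o ≡ bitsThen p o) →
  (∀ o → block b (toℕ v) (n ∸ suc (toℕ v)) o ≡ bitsThen q o) →
  (∀ o → block c (toℕ v) (n ∸ suc (toℕ v)) o ≡ bitsThen r o) →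
  ∀ o → blocks a b c (toℕ v) (n ∸ suc (toℕ v)) o ≡ bits (Vec.concat (p ∷ q ∷ r ∷ [])) ++ o
blocks-bits {n} a b c p q r v at bt ct o = begin
  blocks a b c x y o                              ≡⟨ at _ ⟩
  bitsThen p (block b x y (block c x y (# ∷ o)))  ≡⟨ cong (bitsThen p) (bt _) ⟩
  bitsThen p (bitsThen q (block c x y (# ∷ o)))   ≡⟨ cong (bitsThen p ∘ bitsThen q) (ct _) ⟩
  bitsThen p (bitsThen q (bitsThen r (# ∷ o)))    ≡⟨ bitsThen-concat p q r (# ∷ o) ⟨
  bitsThen (Vec.concat (p ∷ q ∷ r ∷ [])) (# ∷ o)  ≡⟨ bits-++ (Vec.concat (p ∷ q ∷ r ∷ [])) o ⟨
  bits (Vec.concat (p ∷ q ∷ r ∷ [])) ++ o         ∎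
  where
  open ≡-Reasoning
  x = toℕ v
  y = n ∸ suc (toℕ v)

unary-++ : ∀ l o → unary l ++ o ≡ ones l ++ # ∷ o
unary-++ l o = ++-assoc (ones l) [ # ] o

ones-+ : ∀ k l o → ones (k + l) ++ o ≡ ones k ++ (ones l ++ o)
ones-+ zero    l o = refl
ones-+ (suc k) l o = cong (𝟏 ∷_) (ones-+ k l o)

repeat-ones : ∀ j → repeat j [ 𝟏 ] ≡ ones j
repeat-ones zero    = refl
repeat-ones (suc j) = cong (𝟏 ∷_) (repeat-ones j)

concatMap-allFin : ∀ {l} (F : Fin l → Word) → concatMap F (allFin l) ≡ concat (tabulate F)
concatMap-allFin F = cong concat (map-tabulate id F)

concat-tabulate-+ : ∀ k {l} (F : Fin (k + l) → Word) o →
  concat (tabulate F) ++ o ≡ concat (tabulate (F ∘ (_↑ˡ l))) ++ (concat (tabulate (F ∘ (k ↑ʳ_))) ++ o)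
concat-tabulate-+ zero    F o = refl
concat-tabulate-+ (suc k) {l} F o = begin
  (F zero ++ concat (tabulate (F ∘ suc))) ++ o         ≡⟨ ++-assoc (F zero) _ o ⟩
  F zero ++ (concat (tabulate (F ∘ suc)) ++ o)         ≡⟨ cong (F zero ++_) (concat-tabulate-+ k (F ∘ suc) o) ⟩
  F zero ++ (concat (tabulate (F ∘ (_↑ˡ l) ∘ suc)) ++ (concat (tabulate (F ∘ (suc k ↑ʳ_))) ++ o)) ≡⟨ ++-assoc (F zero) _ _ ⟨
  _ ∎
  where open ≡-Reasoning

foldr-tabulate : ∀ {A : Set} {l} (g : A → Word → Word) (h : Fin l → A) (F : Fin l → Word) o →
  (∀ x o → g (h x) o ≡ F x ++ o) → foldr g o (tabulate h) ≡ concat (tabulate F) ++ o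
foldr-tabulate {l = zero}  g h F o eq = refl
foldr-tabulate {l = suc l} g h F o eq = begin
  g (h zero) (foldr g o (tabulate (h ∘ suc)))     ≡⟨ cong (g (h zero)) (foldr-tabulate g (h ∘ suc) (F ∘ suc) o (eq ∘ suc)) ⟩
  g (h zero) (concat (tabulate (F ∘ suc)) ++ o)   ≡⟨ eq zero _ ⟩
  F zero ++ (concat (tabulate (F ∘ suc)) ++ o)    ≡⟨ ++-assoc (F zero) _ o ⟨
  concat (tabulate F) ++ o                        ∎
  where open ≡-Reasoning

rowsFrom-tabulate : ∀ row p q (F : Fin q → Word) o →
  (∀ v o → row (p + toℕ v) (q ∸ suc (toℕ v)) o ≡ F v ++ o) → rowsFrom row p q o ≡ concat (tabulate F) ++ o
rowsFrom-tabulate row p zero    F o eq = refl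
rowsFrom-tabulate row p (suc q) F o eq = begin
  row p q (rowsFrom row (suc p) q o)
    ≡⟨ cong (row p q) (rowsFrom-tabulate row (suc p) q (F ∘ suc) o
         λ v o → trans (cong (λ k → row k (q ∸ suc (toℕ v)) o) (sym (+-suc p (toℕ v)))) (eq (suc v) o)) ⟩
  row p q (concat (tabulate (F ∘ suc)) ++ o)
    ≡⟨ trans (cong (λ k → row k q _) (sym (+-identityʳ p))) (eq zero _) ⟩
  F zero ++ (concat (tabulate (F ∘ suc)) ++ o)
    ≡⟨ ++-assoc (F zero) _ o ⟨
  concat (tabulate F) ++ o ∎
  where open ≡-Reasoning

repeat-tabulate : ∀ l w (F : Fin l → Word) → (∀ x → F x ≡ w) → repeat l w ≡ concat (tabulate F)
repeat-tabulate zero    w F eq = refl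
repeat-tabulate (suc l) w F eq = cong₂ _++_ (sym (eq zero)) (repeat-tabulate l w (F ∘ suc) (eq ∘ suc))

ones-prefix : ∀ j o → j < length (ones j ++ # ∷ o)
ones-prefix zero    o = s≤s z≤n
ones-prefix (suc j) o = s≤s (ones-prefix j o)

length-suffix : ∀ xs (a : Symbol) ys → length ys < length (xs ++ a ∷ ys)
length-suffix xs a ys rewrite length-++ xs {a ∷ ys} = m≤n+m (suc (length ys)) (length xs)

-- The words of an instance and of its image

module Encoding (I : MDSTInstance) where
  open MDSTInstance I renaming (order to n; size to m)
  open Reduction I
  open Output {n}

  rows : List Row
  rows = tabulate ends

  boundsWord : Word
  boundsWord = encodeBounds ℓ u

  edgesWord : Word
  edgesWord = ones (length rows) ++ # ∷ rowsThen rows boundsWord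

  input-word : encodeMDST I ≡ ones n ++ # ∷ edgesWord
  input-word rewrite length-tabulate ends = begin
    (unary n ++ (unary m ++ incidence)) ++ boundsWord    ≡⟨ ++-assoc (unary n) _ _ ⟩
    unary n ++ ((unary m ++ incidence) ++ boundsWord)    ≡⟨ cong (unary n ++_) (++-assoc (unary m) _ _) ⟩
    unary n ++ (unary m ++ (incidence ++ boundsWord))    ≡⟨ unary-++ n _ ⟩
    ones n ++ # ∷ (unary m ++ (incidence ++ boundsWord)) ≡⟨ cong (λ o → ones n ++ # ∷ o) (unary-++ m _) ⟩
    ones n ++ # ∷ (ones m ++ # ∷ (incidence ++ boundsWord))
      ≡⟨ cong (λ o → ones n ++ # ∷ (ones m ++ # ∷ o)) (begin
           incidence ++ boundsWord                             ≡⟨ cong (_++ boundsWord) (concatMap-allFin (bits ∘ ends)) ⟩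
           concat (tabulate (bits ∘ ends)) ++ boundsWord       ≡⟨ foldr-tabulate _ ends _ boundsWord (λ e o → sym (bits-++ (ends e) o)) ⟨
           rowsThen rows boundsWord                            ∎) ⟩
    ones n ++ # ∷ (ones m ++ # ∷ rowsThen rows boundsWord) ∎
    where
    open ≡-Reasoning
    incidence : Word
    incidence = concatMap (λ e → bits (ends e)) (allFin m)

  -- `3 * n` unfolds to `n + (n + (n + 0))`, and `gadget k` for each fixed `k` to the matching
  -- injection. Hence the numbering runs through the original edges and then the three kinds.
  split-edges : ∀ (F : Edge′ → Word) o → concatMap F (allFin (m + 3 * n)) ++ o ≡
    concat (tabulate (F ∘ original)) ++ (concat (tabulate (F ∘ gadget l₀)) ++
      (concat (tabulate (F ∘ gadget l₁)) ++ (concat (tabulate (F ∘ gadget l₂)) ++ o)))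
  split-edges F o = begin
    concatMap F (allFin (m + 3 * n)) ++ o     ≡⟨ cong (_++ o) (concatMap-allFin F) ⟩
    concat (tabulate F) ++ o                  ≡⟨ concat-tabulate-+ m F o ⟩
    A ++ (concat (tabulate G) ++ o)           ≡⟨ cong (A ++_) (concat-tabulate-+ n G o) ⟩
    A ++ (A₀ ++ (concat (tabulate (G ∘ (n ↑ʳ_))) ++ o))
      ≡⟨ cong (λ o → A ++ (A₀ ++ o)) (concat-tabulate-+ n (G ∘ (n ↑ʳ_)) o) ⟩
    A ++ (A₀ ++ (A₁ ++ (concat (tabulate (G ∘ (n ↑ʳ_) ∘ (n ↑ʳ_))) ++ o)))
      ≡⟨ cong (λ o → A ++ (A₀ ++ (A₁ ++ o))) (concat-tabulate-+ n (G ∘ (n ↑ʳ_) ∘ (n ↑ʳ_)) o) ⟩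
    A ++ (A₀ ++ (A₁ ++ (concat (tabulate (F ∘ gadget l₂)) ++ o))) ∎
    where
    open ≡-Reasoning
    G : Fin (3 * n) → Word
    G = F ∘ (m ↑ʳ_)
    A A₀ A₁ : Word
    A  = concat (tabulate (F ∘ original))
    A₀ = concat (tabulate (F ∘ gadget l₀))
    A₁ = concat (tabulate (F ∘ gadget l₁))

  gadget-rows : ∀ k a b c (p q r : Vertex → Subset n) → (∀ v → bits (Vec.concat (p v ∷ q v ∷ r v ∷ [])) ≡ bits (ends′ (gadget k v))) →
    (∀ v o → block a (toℕ v) (n ∸ suc (toℕ v)) o ≡ bitsThen (p v) o) →
    (∀ v o → block b (toℕ v) (n ∸ suc (toℕ v)) o ≡ bitsThen (q v) o) →
    (∀ v o → block c (toℕ v) (n ∸ suc (toℕ v)) o ≡ bitsThen (r v) o) →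
    ∀ o → rowsFrom (blocks a b c) 0 n o ≡ concat (tabulate (bits ∘ ends′ ∘ gadget k)) ++ o
  gadget-rows k a b c p q r eq at bt ct o = rowsFrom-tabulate (blocks a b c) 0 n _ o λ v o →
    trans (blocks-bits a b c (p v) (q v) (r v) v (at v) (bt v) (ct v) o) (cong (_++ o) (eq v))

  matrix-word : ∀ o → matrixThen m rows o ≡ concatMap (bits ∘ ends′) (allFin (m + 3 * n)) ++ o
  matrix-word o = begin
    foldr originalRow (rowsFrom (blocks 𝟎 𝟏 𝟏) 0 n (rowsFrom (blocks 𝟏 𝟎 𝟏) 0 n (rowsFrom (blocks 𝟏 𝟏 𝟎) 0 n o))) rows
      ≡⟨ foldr-tabulate originalRow ends (bits ∘ ends′ ∘ original) _ original-row ⟩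
    A ++ rowsFrom (blocks 𝟎 𝟏 𝟏) 0 n (rowsFrom (blocks 𝟏 𝟎 𝟏) 0 n (rowsFrom (blocks 𝟏 𝟏 𝟎) 0 n o))
      ≡⟨ cong (A ++_) (gadget-rows l₀ 𝟎 𝟏 𝟏 (λ _ → ⊥) ⁅_⁆ ⁅_⁆ (λ v → cong bits (sym (ends′-gadget l₀ v))) block-⊥ block-⁅⁆ block-⁅⁆ _) ⟩
    A ++ (A₀ ++ rowsFrom (blocks 𝟏 𝟎 𝟏) 0 n (rowsFrom (blocks 𝟏 𝟏 𝟎) 0 n o))
      ≡⟨ cong (λ o → A ++ (A₀ ++ o)) (gadget-rows l₁ 𝟏 𝟎 𝟏 ⁅_⁆ (λ _ → ⊥) ⁅_⁆ (λ v → cong bits (sym (ends′-gadget l₁ v))) block-⁅⁆ block-⊥ block-⁅⁆ _) ⟩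
    A ++ (A₀ ++ (A₁ ++ rowsFrom (blocks 𝟏 𝟏 𝟎) 0 n o))
      ≡⟨ cong (λ o → A ++ (A₀ ++ (A₁ ++ o))) (gadget-rows l₂ 𝟏 𝟏 𝟎 ⁅_⁆ ⁅_⁆ (λ _ → ⊥) (λ v → cong bits (sym (ends′-gadget l₂ v))) block-⁅⁆ block-⁅⁆ block-⊥ _) ⟩
    A ++ (A₀ ++ (A₁ ++ (concat (tabulate (bits ∘ ends′ ∘ gadget l₂)) ++ o)))
      ≡⟨ split-edges (bits ∘ ends′) o ⟨
    concatMap (bits ∘ ends′) (allFin (m + 3 * n)) ++ o ∎
    where
    open ≡-Reasoning
    A A₀ A₁ : Word
    A  = concat (tabulate (bits ∘ ends′ ∘ original))
    A₀ = concat (tabulate (bits ∘ ends′ ∘ gadget l₀))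
    A₁ = concat (tabulate (bits ∘ ends′ ∘ gadget l₁))
    original-row : ∀ e o → originalRow (ends e) o ≡ bits (ends′ (original e)) ++ o
    original-row e o = begin
      bitsThen (ends e) (zeros n ++ (zeros n ++ (# ∷ o)))                 ≡⟨ cong (bitsThen (ends e)) (zeros-⊥ n _) ⟩
      bitsThen (ends e) (bitsThen (⊥ {n}) (zeros n ++ (# ∷ o)))           ≡⟨ cong (bitsThen (ends e) ∘ bitsThen (⊥ {n})) (zeros-⊥ n _) ⟩
      bitsThen (ends e) (bitsThen (⊥ {n}) (bitsThen (⊥ {n}) (# ∷ o)))     ≡⟨ bitsThen-concat (ends e) ⊥ ⊥ (# ∷ o) ⟨
      bitsThen (Vec.concat (originalEnds e)) (# ∷ o)                      ≡⟨ bits-++ (Vec.concat (originalEnds e)) o ⟨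
      bits (Vec.concat (originalEnds e)) ++ o                             ≡⟨ cong (λ p → bits p ++ o) (ends′-original e) ⟨
      bits (ends′ (original e)) ++ o                                      ∎

  arcRow : Edge′ → Word
  arcRow x = bits (Vec.tabulate (′.arc x))

  arcRow-arcs : ∀ x → arcRow x ≡ bits (arcs x)
  arcRow-arcs x = cong bits (tabulate∘lookup (arcs x))

  digraph-word : ∀ o → digraphThen m rows o ≡ encodeDigraph dependency′ ++ o
  digraph-word o = begin
    foldr (originalArcsRow m) (gadgets (gadgets (gadgets o))) rows
      ≡⟨ foldr-tabulate (originalArcsRow m) ends (arcRow ∘ original) _ original-row ⟩
    A ++ gadgets (gadgets (gadgets o))      ≡⟨ cong (A ++_) (gadgets-word l₀ _) ⟩
    A ++ (A₀ ++ gadgets (gadgets o))        ≡⟨ cong (λ o → A ++ (A₀ ++ o)) (gadgets-word l₁ _) ⟩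
    A ++ (A₀ ++ (A₁ ++ gadgets o))          ≡⟨ cong (λ o → A ++ (A₀ ++ (A₁ ++ o))) (gadgets-word l₂ _) ⟩
    A ++ (A₀ ++ (A₁ ++ (concat (tabulate (arcRow ∘ gadget l₂)) ++ o)))
                                            ≡⟨ split-edges arcRow o ⟨
    encodeDigraph dependency′ ++ o ∎
    where
    open ≡-Reasoning
    A A₀ A₁ : Word
    A  = concat (tabulate (arcRow ∘ original))
    A₀ = concat (tabulate (arcRow ∘ gadget l₀))
    A₁ = concat (tabulate (arcRow ∘ gadget l₁))

    gadgets : Word → Word
    gadgets = rowsFrom (gadgetArcsRow m) 0 n

    original-row : ∀ e o → originalArcsRow m (ends e) o ≡ arcRow (original e) ++ o
    original-row e o = begin
      zeros m ++ (zeros n ++ (bitsThen (ends e) (bitsThen (ends e) (# ∷ o))))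
        ≡⟨ zeros-⊥ m _ ⟩
      bitsThen (⊥ {m}) (zeros n ++ (bitsThen (ends e) (bitsThen (ends e) (# ∷ o))))
        ≡⟨ cong (bitsThen (⊥ {m})) (zeros-⊥ n _) ⟩
      bitsThen (⊥ {m}) (bitsThen (⊥ {n}) (bitsThen (ends e) (bitsThen (ends e) (# ∷ o))))
        ≡⟨ cong (bitsThen (⊥ {m})) (bitsThen-concat ⊥ (ends e) (ends e) (# ∷ o)) ⟨
      bitsThen (⊥ {m}) (bitsThen (Vec.concat (⊥ ∷ ends e ∷ ends e ∷ [])) (# ∷ o))
        ≡⟨ bitsThen-++ (⊥ {m}) _ (# ∷ o) ⟨
      bitsThen (originalArcs e) (# ∷ o)
        ≡⟨ bits-++ (originalArcs e) o ⟨
      bits (originalArcs e) ++ o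
        ≡⟨ cong (λ p → bits p ++ o) (arcs-original e) ⟨
      bits (arcs (original e)) ++ o
        ≡⟨ cong (_++ o) (arcRow-arcs (original e)) ⟨
      arcRow (original e) ++ o ∎

    ⊥-++ : ∀ k {l} → ⊥ {k} Vec.++ ⊥ {l} ≡ ⊥
    ⊥-++ zero    = refl
    ⊥-++ (suc k) = cong (false ∷_) (⊥-++ k)

    zero-row : ⊥ {m} Vec.++ Vec.concat (⊥ {n} ∷ ⊥ ∷ ⊥ ∷ []) ≡ ⊥
    zero-row = trans (cong (⊥ {m} Vec.++_) (trans (cong (⊥ {n} Vec.++_) (trans (cong (⊥ {n} Vec.++_) (⊥-++ n)) (⊥-++ n))) (⊥-++ n))) (⊥-++ m)

    gadgets-word : ∀ k o → gadgets o ≡ concat (tabulate (arcRow ∘ gadget k)) ++ o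
    gadgets-word k o = rowsFrom-tabulate (gadgetArcsRow m) 0 n _ o λ v o → begin
      zeros m ++ blocks 𝟎 𝟎 𝟎 (toℕ v) (n ∸ suc (toℕ v)) o
        ≡⟨ zeros-⊥ m _ ⟩
      bitsThen (⊥ {m}) (blocks 𝟎 𝟎 𝟎 (toℕ v) (n ∸ suc (toℕ v)) o)
        ≡⟨ cong (bitsThen (⊥ {m})) (trans (blocks-bits 𝟎 𝟎 𝟎 ⊥ ⊥ ⊥ v (block-⊥ v) (block-⊥ v) (block-⊥ v) o) (bits-++ _ o)) ⟩
      bitsThen (⊥ {m}) (bitsThen (Vec.concat (⊥ {n} ∷ ⊥ ∷ ⊥ ∷ [])) (# ∷ o))
        ≡⟨ bitsThen-++ (⊥ {m}) _ (# ∷ o) ⟨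
      bitsThen (⊥ {m} Vec.++ Vec.concat (⊥ {n} ∷ ⊥ ∷ ⊥ ∷ [])) (# ∷ o)
        ≡⟨ bits-++ _ o ⟨
      bits (⊥ {m} Vec.++ Vec.concat (⊥ {n} ∷ ⊥ ∷ ⊥ ∷ [])) ++ o
        ≡⟨ cong (λ p → bits p ++ o) (trans zero-row (sym (arcs-gadget k v))) ⟩
      bits (arcs (gadget k v)) ++ o
        ≡⟨ cong (_++ o) (arcRow-arcs (gadget k v)) ⟨
      arcRow (gadget k v) ++ o ∎

  bounds-word : boundsThen m boundsWord ≡ encodeBounds (bound′ ℓ) (bound′ u)
  bounds-word = begin
    repeat m (binary 0 ++ binary 0) ++ (repeat n (binary 0 ++ binary 0) ++ (repeat n (binary 1 ++ binary 1) ++ boundsWord))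
      ≡⟨ cong₂ _++_ (repeat-tabulate m _ _ λ e → pair _ _ (bound-original ℓ e) (bound-original u e))
           (cong₂ _++_ (repeat-tabulate n _ _ (gadget-pair l₀)) (cong₂ _++_ (repeat-tabulate n _ _ (gadget-pair l₁)) last)) ⟩
    concat (tabulate (F ∘ original)) ++ (concat (tabulate (F ∘ gadget l₀)) ++
      (concat (tabulate (F ∘ gadget l₁)) ++ (concat (tabulate (F ∘ gadget l₂)) ++ [])))
      ≡⟨ split-edges F [] ⟨
    encodeBounds (bound′ ℓ) (bound′ u) ++ []
      ≡⟨ ++-identityʳ _ ⟩
    encodeBounds (bound′ ℓ) (bound′ u) ∎
    where
    open ≡-Reasoning
    F : Edge′ → Word
    F x = binary (bound′ ℓ x) ++ binary (bound′ u x)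
    pair : ∀ {a b} c d → a ≡ c → b ≡ d → binary a ++ binary b ≡ binary c ++ binary d
    pair _ _ = cong₂ (λ a b → binary a ++ binary b)
    gadget-pair : ∀ k v → F (gadget k v) ≡ binary (gadgetBound ℓ k v) ++ binary (gadgetBound u k v)
    gadget-pair k v = pair _ _ (bound-gadget ℓ k v) (bound-gadget u k v)
    last : boundsWord ≡ concat (tabulate (F ∘ gadget l₂)) ++ []
    last = begin
      boundsWord                                               ≡⟨ concatMap-allFin (λ v → binary (ℓ v) ++ binary (u v)) ⟩
      concat (tabulate λ v → binary (ℓ v) ++ binary (u v))     ≡⟨ cong concat (tabulate-cong (gadget-pair l₂)) ⟨
      concat (tabulate (F ∘ gadget l₂))                        ≡⟨ ++-identityʳ _ ⟨
      concat (tabulate (F ∘ gadget l₂)) ++ []                  ∎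

  triple-ones : ∀ o → triple o ≡ ones (3 * n) ++ o
  triple-ones o rewrite repeat-ones n = sym (begin
    ones (n + (n + (n + 0))) ++ o                ≡⟨ ones-+ n _ o ⟩
    ones n ++ (ones (n + (n + 0)) ++ o)          ≡⟨ cong (ones n ++_) (ones-+ n _ o) ⟩
    ones n ++ (ones n ++ (ones (n + 0) ++ o))    ≡⟨ cong (λ k → ones n ++ (ones n ++ (ones k ++ o))) (+-identityʳ n) ⟩
    ones n ++ (ones n ++ (ones n ++ o))          ∎)
    where open ≡-Reasoning

  header-word : ∀ o → headerThen m o ≡ unary (3 * n) ++ (unary (m + 3 * n) ++ o)
  header-word o = begin
    triple (# ∷ (repeat m [ 𝟏 ] ++ triple (# ∷ o)))                   ≡⟨ triple-ones _ ⟩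
    ones (3 * n) ++ # ∷ (repeat m [ 𝟏 ] ++ triple (# ∷ o))            ≡⟨ unary-++ (3 * n) _ ⟨
    unary (3 * n) ++ (repeat m [ 𝟏 ] ++ triple (# ∷ o))               ≡⟨ cong (unary (3 * n) ++_) (begin
      repeat m [ 𝟏 ] ++ triple (# ∷ o)        ≡⟨ cong₂ _++_ (repeat-ones m) (triple-ones (# ∷ o)) ⟩
      ones m ++ (ones (3 * n) ++ # ∷ o)       ≡⟨ ones-+ m (3 * n) (# ∷ o) ⟨
      ones (m + 3 * n) ++ # ∷ o               ≡⟨ unary-++ (m + 3 * n) o ⟨
      unary (m + 3 * n) ++ o                  ∎) ⟩
    unary (3 * n) ++ (unary (m + 3 * n) ++ o)                         ∎
    where open ≡-Reasoning

  output-word : (let l = length rows in headerThen l (matrixThen l rows (digraphThen l rows (boundsThen l boundsWord)))) ≡ encodeDCST instance′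
  output-word rewrite length-tabulate ends = begin
    headerThen m (matrixThen m rows (digraphThen m rows (boundsThen m boundsWord)))
      ≡⟨ header-word _ ⟩
    unary (3 * n) ++ (unary (m + 3 * n) ++ matrixThen m rows (digraphThen m rows (boundsThen m boundsWord)))
      ≡⟨ cong (λ o → unary (3 * n) ++ (unary (m + 3 * n) ++ o)) (begin
           matrixThen m rows (digraphThen m rows (boundsThen m boundsWord)) ≡⟨ matrix-word _ ⟩
           incidence ++ digraphThen m rows (boundsThen m boundsWord)        ≡⟨ cong (incidence ++_) (digraph-word _) ⟩
           incidence ++ (encodeDigraph dependency′ ++ boundsThen m boundsWord)
             ≡⟨ cong (λ o → incidence ++ (encodeDigraph dependency′ ++ o)) bounds-word ⟩
           incidence ++ tail ∎) ⟩
    unary (3 * n) ++ (unary (m + 3 * n) ++ (incidence ++ tail))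
      ≡⟨ cong (unary (3 * n) ++_) (++-assoc (unary (m + 3 * n)) incidence tail) ⟨
    unary (3 * n) ++ ((unary (m + 3 * n) ++ incidence) ++ tail)
      ≡⟨ ++-assoc (unary (3 * n)) (unary (m + 3 * n) ++ incidence) tail ⟨
    encodeDCST instance′ ∎
    where
    open ≡-Reasoning
    incidence tail : Word
    incidence = concatMap (bits ∘ ends′) (allFin (m + 3 * n))
    tail      = encodeDigraph dependency′ ++ encodeBounds (bound′ ℓ) (bound′ u)

  -- With the next two, this bounds all loops: they count vertices, edges, the `n` bits of a row or
  -- the symbols of the bounds word. Each bound is strict since the input also contains a separator
  -- `#`.
  n<length : n < length (encodeMDST I)
  n<length = subst (λ w → n < length w) (sym input-word) (ones-prefix n _)

  rows<length : length rows < length (encodeMDST I)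
  rows<length = subst (λ w → length rows < length w) (sym input-word)
    (<-trans (ones-prefix (length rows) (rowsThen rows boundsWord)) (length-suffix (ones n) # edgesWord))

  boundsWord<length : length boundsWord < length (encodeMDST I)
  boundsWord<length = subst (λ w → length boundsWord < length w) (sym input-word) (≤-<-trans (suffix rows)
    (<-trans (length-suffix (ones (length rows)) # (rowsThen rows boundsWord)) (length-suffix (ones n) # edgesWord)))
    where
    suffix : ∀ rs → length boundsWord ≤ length (rowsThen rs boundsWord)
    suffix []       = ≤-refl
    suffix (r ∷ rs) = ≤-trans (suffix rs) (<⇒≤ (length-suffix (bitWord (toList r)) # (rowsThen rs boundsWord)))

-- The polynomial-time reduction

reduce : MDSTInstance → DCSTInstance
reduce = Reduction.instance′

reduce-polynomialTime : PolynomialTime encodeMDST encodeDCST reduce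
reduce-polynomialTime = machine-polynomialTime encodeMDST encodeDCST reduce program inp out
  (λ I → >-nonZero (≤-<-trans z≤n (Encoding.n<length I))) run
  where
  run : ∀ I → ∃[ m ] Exec (length (encodeMDST I)) program (Vec.replicate 10 [] [ inp ]≔ encodeMDST I) m
                     × lookup m out ≡ encodeDCST (reduce I)
  run I = _ , exec-from (cong (λ w → Vec.replicate 10 [] [ inp ]≔ w) input-word) exec , output-word
    where
    open Encoding I
    open Semantics (length (encodeMDST I))
    exec = Output.Correctness.exec-program n<length {rows} rows<length {boundsWord} boundsWord<length

theorem10 : G-mDST ≤ₚ G-DCST
theorem10 = reduce , reduce-polynomialTime , Reduction.correct
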